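{- (1) The maps $\sigma:\mathbf{NExt}(\mathtt{KM_R})\to\mathbf{NExt}(\mathtt{GL_R})$, $\sigma\mathtt{L}=\mathtt{GL_R}\oplus\{T(\Gamma/\Delta):\Gamma/\Delta\in\mathtt{L}\}$, and $\rho:\mathbf{NExt}(\mathtt{GL_R})\to\mathbf{NExt}(\mathtt{KM_R})$, $\rho\mathtt{M}=\{\Gamma/\Delta:T(\Gamma/\Delta)\in\mathtt{M}\}$, are mutually inverse complete lattice isomorphisms. (2) The maps $\sigma:\mathbf{NExt}(\mathtt{KM})\to\mathbf{NExt}(\mathtt{GL})$, $\sigma\mathtt{L}=\mathtt{GL}\oplus\{T\varphi:\varphi\in\mathtt{L}\}$, and $\rho:\mathbf{NExt}(\mathtt{GL})\to\mathbf{NExt}(\mathtt{KM})$, $\rho\mathtt{M}=\{\varphi:T\varphi\in\mathtt{M}\}$, are mutually inverse complete lattice isomorphisms.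
   Context: Msi formulae use $\land,\lor,\to,\boxtimes,\bot,\top$. $\mathtt{IPCK}$: least substitution-closed set containing $\mathtt{IPC}$ and $\boxtimes(p\to q)\to(\boxtimes p\to\boxtimes q)$, closed under modus ponens and $\varphi\mapsto\boxtimes\varphi$; msi-logics are such sets extending $\mathtt{IPCK}$. $\mathtt{KM}=\mathtt{IPCK}\oplus p\to\boxtimes p\oplus(\boxtimes p\to p)\to p\oplus\boxtimes p\to(q\lor(q\to p))$. A rule is a pair $\Gamma/\Delta$ of finite sets of formulae; rule systems are sets of rules closed under substitution, reflexivity, weakening on both sides and cut. Msi-rule systems contain $/\varphi$ for $\varphi\in\mathtt{IPCK}$, $\varphi,\varphi\to\psi/\psi$, $\varphi/\boxtimes\varphi$. Normal modal logics/rule systems over $\land,\lor,\neg,\square,\bot,\top$ as usual (extending $\mathtt{K}$, closed under modus ponens and necessitation). $\mathtt{GL}=\mathtt{K}\oplus\square(\square p\to p)\to\square p$. $\mathtt{X_R}$ is the least rule system of the relevant kind containing $/\varphi$ for $\varphi\in\mathtt{X}$; $\mathbf{NExt}(\mathtt{X})$ is the set of logics (resp. rule systems) of the relevant kind extending $\mathtt{X}$, a complete lattice with intersection as meet and $\oplus$ (least logic/rule system containing the sets) as join. Write $\square^+\varphi:=\square\varphi\land\varphi$. Translation $T$: $T(\bot)=\bot$, $T(\top)=\top$, $T(p)=\square^+p$, commutes with $\land,\lor$, $T(\varphi\to\psi)=\square^+(\neg T\varphi\lor T\psi)$, $T(\boxtimes\varphi)=\square T\varphi$, $T(\Gamma/\Delta)=T[\Gamma]/T[\Delta]$.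 -}

module Defs where

open import Data.Nat using (ℕ)
import Data.Bool as B
open B using (Bool; true)
open import Data.List using (List; []; _∷_; map)
open import Data.List.Relation.Binary.Subset.Propositional renaming (_⊆_ to _⊆ˡ_)
open import Data.Product using (Σ; _×_; _,_)
open import Data.Sum using (_⊎_)
open import Data.Empty using () renaming (⊥ to Empty)
open import Data.Unit using () renaming (⊤ to Unit)
open import Function using (_∘_)
open import Relation.Binary.PropositionalEquality using (_≡_)
open import Relation.Unary using (Pred; _⊆_; _∪_; _≐_)
open import Level using (0ℓ)

infixr 6 _∧ᵢ_
infixr 5 _∨ᵢ_
infixr 4 _→ᵢ_

data IFm : Set where
  pᵢ : ℕ → IFm
  ⊥ᵢ ⊤ᵢ : IFm
  _∧ᵢ_ _∨ᵢ_ _→ᵢ_ : IFm → IFm → IFm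
  ⊠ : IFm → IFm

substI : (ℕ → IFm) → IFm → IFm
substI s (pᵢ n) = s n
substI s ⊥ᵢ = ⊥ᵢ
substI s ⊤ᵢ = ⊤ᵢ
substI s (φ ∧ᵢ ψ) = substI s φ ∧ᵢ substI s ψ
substI s (φ ∨ᵢ ψ) = substI s φ ∨ᵢ substI s ψ
substI s (φ →ᵢ ψ) = substI s φ →ᵢ substI s ψ
substI s (⊠ φ) = ⊠ (substI s φ)

infixr 6 _∧ₘ_
infixr 5 _∨ₘ_
infixr 4 _→ₘ_

data MFm : Set where
  pₘ : ℕ → MFm
  ⊥ₘ ⊤ₘ : MFm
  _∧ₘ_ _∨ₘ_ : MFm → MFm → MFm
  ¬ₘ □ : MFm → MFm

_→ₘ_ : MFm → MFm → MFm
φ →ₘ ψ = ¬ₘ φ ∨ₘ ψ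

substM : (ℕ → MFm) → MFm → MFm
substM s (pₘ n) = s n
substM s ⊥ₘ = ⊥ₘ
substM s ⊤ₘ = ⊤ₘ
substM s (φ ∧ₘ ψ) = substM s φ ∧ₘ substM s ψ
substM s (φ ∨ₘ ψ) = substM s φ ∨ₘ substM s ψ
substM s (¬ₘ φ) = ¬ₘ (substM s φ)
substM s (□ φ) = □ (substM s φ)

□⁺ : MFm → MFm
□⁺ φ = □ φ ∧ₘ φ

-- Rules Γ/Δ (finite sets represented by lists; weakening below is by
-- membership-inclusion, so order and repetitions are irrelevant)

data Rule (F : Set) : Set where
  _/_ : List F → List F → Rule F

ax/ : {F : Set} → F → Rule F
ax/ φ = [] / (φ ∷ [])

module _ {F : Set} (sb : (ℕ → F) → F → F) where

  substR : (ℕ → F) → Rule F → Rule F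
  substR s (Γ / Δ) = map (sb s) Γ / map (sb s) Δ

  record IsRuleSystem (S : Pred (Rule F) 0ℓ) : Set where
    field
      rs-subst : ∀ s r → S r → S (substR s r)
      rs-refl  : ∀ φ → S ((φ ∷ []) / (φ ∷ []))
      rs-weak  : ∀ Γ Δ Γ' Δ' → Γ ⊆ˡ Γ' → Δ ⊆ˡ Δ' → S (Γ / Δ) → S (Γ' / Δ')
      rs-cut   : ∀ Γ Δ φ → S (Γ / (φ ∷ Δ)) → S ((φ ∷ Γ) / Δ) → S (Γ / Δ)

  data RSClosure (Bs : Pred (Rule F) 0ℓ) : Pred (Rule F) 0ℓ where
    base : ∀ {r} → Bs r → RSClosure Bs r
    sub  : ∀ s {r} → RSClosure Bs r → RSClosure Bs (substR s r)
    refl : ∀ φ → RSClosure Bs ((φ ∷ []) / (φ ∷ []))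
    weak : ∀ {Γ Δ Γ' Δ'} → Γ ⊆ˡ Γ' → Δ ⊆ˡ Δ' →
           RSClosure Bs (Γ / Δ) → RSClosure Bs (Γ' / Δ')
    cut  : ∀ {Γ Δ} φ → RSClosure Bs (Γ / (φ ∷ Δ)) →
           RSClosure Bs ((φ ∷ Γ) / Δ) → RSClosure Bs (Γ / Δ)

p q r : IFm
p = pᵢ 0
q = pᵢ 1
r = pᵢ 2

data IPCKAx : Pred IFm 0ℓ where
  ax1  : IPCKAx (p →ᵢ (q →ᵢ p))
  ax2  : IPCKAx ((p →ᵢ (q →ᵢ r)) →ᵢ ((p →ᵢ q) →ᵢ (p →ᵢ r)))
  ax3  : IPCKAx (p ∧ᵢ q →ᵢ p)
  ax4  : IPCKAx (p ∧ᵢ q →ᵢ q)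
  ax5  : IPCKAx (p →ᵢ (q →ᵢ p ∧ᵢ q))
  ax6  : IPCKAx (p →ᵢ p ∨ᵢ q)
  ax7  : IPCKAx (q →ᵢ p ∨ᵢ q)
  ax8  : IPCKAx ((p →ᵢ r) →ᵢ ((q →ᵢ r) →ᵢ (p ∨ᵢ q →ᵢ r)))
  ax9  : IPCKAx (⊥ᵢ →ᵢ p)
  ax10 : IPCKAx ⊤ᵢ
  axK  : IPCKAx (⊠ (p →ᵢ q) →ᵢ (⊠ p →ᵢ ⊠ q))

data MsiCl (A : Pred IFm 0ℓ) : Pred IFm 0ℓ where
  base : ∀ {φ} → A φ → MsiCl A φ
  ipck : ∀ {φ} → IPCKAx φ → MsiCl A φ
  sub  : ∀ s {φ} → MsiCl A φ → MsiCl A (substI s φ)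
  mp   : ∀ {φ ψ} → MsiCl A φ → MsiCl A (φ →ᵢ ψ) → MsiCl A ψ
  nec  : ∀ {φ} → MsiCl A φ → MsiCl A (⊠ φ)

∅ᵢ : Pred IFm 0ℓ
∅ᵢ _ = Empty

IPCK : Pred IFm 0ℓ
IPCK = MsiCl ∅ᵢ

record IsMsiLogic (L : Pred IFm 0ℓ) : Set where
  field
    ml-IPCK  : IPCK ⊆ L
    ml-subst : ∀ s φ → L φ → L (substI s φ)
    ml-mp    : ∀ φ ψ → L φ → L (φ →ᵢ ψ) → L ψ
    ml-nec   : ∀ φ → L φ → L (⊠ φ)

data KMAx : Pred IFm 0ℓ where
  km1 : KMAx (p →ᵢ ⊠ p)
  km2 : KMAx ((⊠ p →ᵢ p) →ᵢ p)
  km3 : KMAx (⊠ p →ᵢ (q ∨ᵢ (q →ᵢ p)))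

KM : Pred IFm 0ℓ
KM = MsiCl KMAx

NExtKM : Pred IFm 0ℓ → Set
NExtKM L = IsMsiLogic L × KM ⊆ L

pm qm : MFm
pm = pₘ 0
qm = pₘ 1

data □-free : MFm → Set where
  bf-var : ∀ k → □-free (pₘ k)
  bf-⊥   : □-free ⊥ₘ
  bf-⊤   : □-free ⊤ₘ
  bf-∧   : ∀ {φ ψ} → □-free φ → □-free ψ → □-free (φ ∧ₘ ψ)
  bf-∨   : ∀ {φ ψ} → □-free φ → □-free ψ → □-free (φ ∨ₘ ψ)
  bf-¬   : ∀ {φ} → □-free φ → □-free (¬ₘ φ)

evalB : (ℕ → Bool) → MFm → Bool
evalB V (pₘ k) = V k
evalB V ⊥ₘ = B.false
evalB V ⊤ₘ = B.true
evalB V (φ ∧ₘ ψ) = evalB V φ B.∧ evalB V ψ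
evalB V (φ ∨ₘ ψ) = evalB V φ B.∨ evalB V ψ
evalB V (¬ₘ φ) = B.not (evalB V φ)
evalB V (□ φ) = B.false

Taut : Pred MFm 0ℓ
Taut φ = □-free φ × (∀ V → evalB V φ ≡ true)

KAxM : MFm
KAxM = □ (pm →ₘ qm) →ₘ (□ pm →ₘ □ qm)

data ModCl (A : Pred MFm 0ℓ) : Pred MFm 0ℓ where
  base : ∀ {φ} → A φ → ModCl A φ
  taut : ∀ {φ} → Taut φ → ModCl A φ
  kax  : ModCl A KAxM
  sub  : ∀ s {φ} → ModCl A φ → ModCl A (substM s φ)
  mp   : ∀ {φ ψ} → ModCl A φ → ModCl A (φ →ₘ ψ) → ModCl A ψ
  nec  : ∀ {φ} → ModCl A φ → ModCl A (□ φ)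

∅ₘ : Pred MFm 0ℓ
∅ₘ _ = Empty

K : Pred MFm 0ℓ
K = ModCl ∅ₘ

record IsNormalModalLogic (M : Pred MFm 0ℓ) : Set where
  field
    nl-K     : K ⊆ M
    nl-subst : ∀ s φ → M φ → M (substM s φ)
    nl-mp    : ∀ φ ψ → M φ → M (φ →ₘ ψ) → M ψ
    nl-nec   : ∀ φ → M φ → M (□ φ)

data GLAx : Pred MFm 0ℓ where
  löb : GLAx (□ (□ pm →ₘ pm) →ₘ □ pm)

GL : Pred MFm 0ℓ
GL = ModCl GLAx

NExtGL : Pred MFm 0ℓ → Set
NExtGL M = IsNormalModalLogic M × GL ⊆ M

data MsiRSBase : Pred (Rule IFm) 0ℓ where
  thm  : ∀ {φ} → IPCK φ → MsiRSBase (ax/ φ)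
  mpR  : ∀ φ ψ → MsiRSBase ((φ ∷ (φ →ᵢ ψ) ∷ []) / (ψ ∷ []))
  necR : ∀ φ → MsiRSBase ((φ ∷ []) / (⊠ φ ∷ []))

data ModRSBase : Pred (Rule MFm) 0ℓ where
  thm  : ∀ {φ} → K φ → ModRSBase (ax/ φ)
  mpR  : ∀ φ ψ → ModRSBase ((φ ∷ (φ →ₘ ψ) ∷ []) / (ψ ∷ []))
  necR : ∀ φ → ModRSBase ((φ ∷ []) / (□ φ ∷ []))

record IsMsiRS (S : Pred (Rule IFm) 0ℓ) : Set where
  field
    is-rs : IsRuleSystem substI S
    msi   : MsiRSBase ⊆ S

record IsModRS (S : Pred (Rule MFm) 0ℓ) : Set where
  field
    is-rs : IsRuleSystem substM S
    modal : ModRSBase ⊆ S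

MsiRS : Pred (Rule IFm) 0ℓ → Pred (Rule IFm) 0ℓ
MsiRS A = RSClosure substI (MsiRSBase ∪ A)

ModRS : Pred (Rule MFm) 0ℓ → Pred (Rule MFm) 0ℓ
ModRS A = RSClosure substM (ModRSBase ∪ A)

axioms/ : {F : Set} → Pred F 0ℓ → Pred (Rule F) 0ℓ
axioms/ X ru = Σ _ λ φ → X φ × ru ≡ ax/ φ

KMR : Pred (Rule IFm) 0ℓ
KMR = MsiRS (axioms/ KM)

GLR : Pred (Rule MFm) 0ℓ
GLR = ModRS (axioms/ GL)

NExtKMR : Pred (Rule IFm) 0ℓ → Set
NExtKMR S = IsMsiRS S × KMR ⊆ S

NExtGLR : Pred (Rule MFm) 0ℓ → Set
NExtGLR S = IsModRS S × GLR ⊆ S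

T : IFm → MFm
T (pᵢ n) = □⁺ (pₘ n)
T ⊥ᵢ = ⊥ₘ
T ⊤ᵢ = ⊤ₘ
T (φ ∧ᵢ ψ) = T φ ∧ₘ T ψ
T (φ ∨ᵢ ψ) = T φ ∨ₘ T ψ
T (φ →ᵢ ψ) = □⁺ (¬ₘ (T φ) ∨ₘ T ψ)
T (⊠ φ) = □ (T φ)

TR : Rule IFm → Rule MFm
TR (Γ / Δ) = map T Γ / map T Δ

σR : Pred (Rule IFm) 0ℓ → Pred (Rule MFm) 0ℓ
σR L = ModRS (GLR ∪ (λ ru → Σ _ λ ru' → L ru' × ru ≡ TR ru'))

ρR : Pred (Rule MFm) 0ℓ → Pred (Rule IFm) 0ℓ
ρR M ru = M (TR ru)

σL : Pred IFm 0ℓ → Pred MFm 0ℓ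
σL L = ModCl (GL ∪ (λ ψ → Σ _ λ φ → L φ × ψ ≡ T φ))

ρL : Pred MFm 0ℓ → Pred IFm 0ℓ
ρL M φ = M (T φ)

⋀ : {F I : Set} → (I → Pred F 0ℓ) → Pred F 0ℓ
⋀ {I = I} Ls x = (i : I) → Ls i x

⋃ : {F I : Set} → (I → Pred F 0ℓ) → Pred F 0ℓ
⋃ {I = I} Ls x = Σ I λ i → Ls i x

⋁KMR : {I : Set} → (I → Pred (Rule IFm) 0ℓ) → Pred (Rule IFm) 0ℓ
⋁KMR Ls = MsiRS (KMR ∪ ⋃ Ls)

⋁GLR : {I : Set} → (I → Pred (Rule MFm) 0ℓ) → Pred (Rule MFm) 0ℓ
⋁GLR Ms = ModRS (GLR ∪ ⋃ Ms)

⋁KM : {I : Set} → (I → Pred IFm 0ℓ) → Pred IFm 0ℓ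
⋁KM Ls = MsiCl (KM ∪ ⋃ Ls)

⋁GL : {I : Set} → (I → Pred MFm 0ℓ) → Pred MFm 0ℓ
⋁GL Ms = ModCl (GL ∪ ⋃ Ms)

record CompleteLatticeIso {A B : Set}
    (NA : Pred A 0ℓ → Set) (NB : Pred B 0ℓ → Set)
    (⋁A : {I : Set} → (I → Pred A 0ℓ) → Pred A 0ℓ)
    (⋁B : {I : Set} → (I → Pred B 0ℓ) → Pred B 0ℓ)
    (f : Pred A 0ℓ → Pred B 0ℓ) (g : Pred B 0ℓ → Pred A 0ℓ) : Set₁ where
  field
    f-into : ∀ L → NA L → NB (f L)
    g-into : ∀ M → NB M → NA (g M)
    g∘f    : ∀ L → NA L → g (f L) ≐ L
    f∘g    : ∀ M → NB M → f (g M) ≐ M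
    f-⋀    : ∀ {I : Set} (Ls : I → Pred A 0ℓ) → (∀ i → NA (Ls i)) →
             f (⋀ Ls) ≐ ⋀ (f ∘ Ls)
    f-⋁    : ∀ {I : Set} (Ls : I → Pred A 0ℓ) → (∀ i → NA (Ls i)) →
             f (⋁A Ls) ≐ ⋁B (f ∘ Ls)
    g-⋀    : ∀ {I : Set} (Ms : I → Pred B 0ℓ) → (∀ i → NB (Ms i)) →
             g (⋀ Ms) ≐ ⋀ (g ∘ Ms)
    g-⋁    : ∀ {I : Set} (Ms : I → Pred B 0ℓ) → (∀ i → NB (Ms i)) →
             g (⋁B Ms) ≐ ⋁A (g ∘ Ms)

{-# OPTIONS --safe #-}

-- Identify a Boolean combination of translations with a list of clauses (a , b),
-- read as ¬ T a ∨ T b; □⁺ of it is then, up to GL, the translation of the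
-- conjunction int of the implications a → b. So every modal formula, with its
-- variables replaced by clauses, evaluates to a list of clauses, where □ becomes
-- ⊠ ∘ int. This is the free Boolean extension of a KM-algebra, done on syntax.
--
-- ρ (σ L) ⊆ L: the rules whose evaluations under int all lie in L contain GL and
-- the translations of L, and T φ evaluates to φ. Classical tautologies evaluate to
-- theorems by case distinction on every clause; km2 yields Löb's axiom, and km1 and
-- km3 make □⁺ of a clause equivalent to an intuitionistic formula.
--
-- M ⊆ σ (ρ M): given formulas χ, call a point critical if it satisfies □ χ ∧ ¬ χ
-- for one of them. Redefine each variable off the critical points to be constant on
-- each region where the truth values of the □ χ are constant, the constants being
-- chosen so that each χ with □ χ true there stays true. By Löb's axiom every
-- failure of □ χ is witnessed by a critical point above, so no □ χ changes its
-- value. The redefined variables are Boolean combinations of open formulas, because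
-- critical points for χ are incomparable. Hence every modal formula or rule is
-- interderivable over GL with a substitution instance that is a translation.

module Submission where

open import Defs
open import Data.Bool as B using (Bool; true; false)
open import Data.Bool.Properties using (T-≡; T-∧)
open import Data.Empty using (⊥-elim)
open import Data.Fin using (Fin; toℕ) renaming (zero to fz; suc to fs)
open import Data.Nat as ℕ using (ℕ; zero; suc; _⊔_; _<_; s≤s)
open import Data.Nat.Properties as ℕₚ using (m⊔n≤o⇒m≤o; m⊔n≤o⇒n≤o)
open import Data.List using (List; []; _∷_; map; _++_; cartesianProductWith; concatMap)
open import Data.List.Membership.DecPropositional ℕₚ._≟_ using (_∈?_)
open import Data.List.Membership.Propositional using (_∈_)
open import Data.List.Membership.Propositional.Properties
  using (∈-++⁺ˡ; ∈-++⁺ʳ; ∈-++⁻; ∈-map⁺; ∈-map⁻; ∈-concatMap⁺; ∈-concatMap⁻)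
open import Data.List.Properties using (map-∘; map-cong; map-id)
open import Data.List.Relation.Binary.Subset.Propositional using (_⊆_)
open import Data.List.Relation.Binary.Subset.Propositional.Properties using (map⁺)
open import Data.List.Relation.Unary.All as All using (All; []; _∷_)
import Data.List.Relation.Unary.All.Properties as Allₚ
open import Data.List.Relation.Unary.Any as Any using (Any; here; there)
import Data.List.Relation.Unary.Any.Properties as Anyₚ
open import Data.Product using (Σ; _×_; _,_; proj₁; proj₂)
open import Data.Sum as Sum using (_⊎_; inj₁; inj₂; [_,_]; [_,_]′)
open import Data.Unit using (⊤; tt)
open import Data.Vec as Vec using (Vec; []; _∷_)
open import Data.Vec.Properties using (lookup∘tabulate)
open import Function using (_∘_; id; Equivalence)
open import Level using (0ℓ)
open import Relation.Unary using (Pred; _≐_) renaming (_⊆_ to _⊆ᵖ_)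
open import Relation.Nullary using (yes; no)
open import Relation.Binary.PropositionalEquality
  using (_≡_; refl; sym; trans; cong; cong₂; subst)

-- Modal derivations

infixl 5 _·_
infix 3 _↔ₘ_

_·_ : ∀ {A φ ψ} → ModCl A (φ →ₘ ψ) → ModCl A φ → ModCl A ψ
d · e = mp e d

_↔ₘ_ : MFm → MFm → MFm
φ ↔ₘ ψ = (φ →ₘ ψ) ∧ₘ (ψ →ₘ φ)

-- Propositional tautologies by truth tables

data BF (n : ℕ) : Set where
  var     : Fin n → BF n
  ⊥ᵇ ⊤ᵇ   : BF n
  _⩓_ _⩔_ : BF n → BF n → BF n
  ∼_      : BF n → BF n

infixr 6 _⩓_
infixr 5 _⩔_
infixr 4 _⇒_
infix 3 _⇔_
infix 8 ∼_

_⇒_ _⇔_ : ∀ {n} → BF n → BF n → BF n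
a ⇒ b = ∼ a ⩔ b
a ⇔ b = (a ⇒ b) ⩓ (b ⇒ a)

⟪_⟫ : ∀ {n} → BF n → Vec MFm n → MFm
⟪ var i ⟫ ρ = Vec.lookup ρ i
⟪ ⊥ᵇ ⟫ ρ = ⊥ₘ
⟪ ⊤ᵇ ⟫ ρ = ⊤ₘ
⟪ a ⩓ b ⟫ ρ = ⟪ a ⟫ ρ ∧ₘ ⟪ b ⟫ ρ
⟪ a ⩔ b ⟫ ρ = ⟪ a ⟫ ρ ∨ₘ ⟪ b ⟫ ρ
⟪ ∼ a ⟫ ρ = ¬ₘ (⟪ a ⟫ ρ)

evalBF : ∀ {n} → Vec Bool n → BF n → Bool
evalBF v (var i) = Vec.lookup v i
evalBF v ⊥ᵇ = false
evalBF v ⊤ᵇ = true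
evalBF v (a ⩓ b) = evalBF v a B.∧ evalBF v b
evalBF v (a ⩔ b) = evalBF v a B.∨ evalBF v b
evalBF v (∼ a) = B.not (evalBF v a)

allVec : ∀ n → (Vec Bool n → Bool) → Bool
allVec zero f = f []
allVec (suc n) f = allVec n (f ∘ (true ∷_)) B.∧ allVec n (f ∘ (false ∷_))

allVec-sound : ∀ n f → B.T (allVec n f) → ∀ v → B.T (f v)
allVec-sound zero f h [] = h
allVec-sound (suc n) f h (true ∷ v) =
  allVec-sound n (f ∘ (true ∷_)) (proj₁ (Equivalence.to T-∧ h)) v
allVec-sound (suc n) f h (false ∷ v) =
  allVec-sound n (f ∘ (false ∷_)) (proj₂ (Equivalence.to T-∧ h)) v

-- Computes to the unit type on a concrete tautology, so that the implicit arguments of `taut₁` to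
-- `taut₆` are filled in by evaluation.
Valid : ∀ {n} → BF n → Set
Valid {n} a = B.T (allVec n (λ v → evalBF v a))

schema : ∀ {n} → BF n → MFm
schema a = ⟪ a ⟫ (Vec.tabulate (pₘ ∘ toℕ))

schema-□-free : ∀ {n} (a : BF n) → □-free (schema a)
schema-□-free (var i) rewrite lookup∘tabulate (pₘ ∘ toℕ) i = bf-var (toℕ i)
schema-□-free ⊥ᵇ = bf-⊥
schema-□-free ⊤ᵇ = bf-⊤
schema-□-free (a ⩓ b) = bf-∧ (schema-□-free a) (schema-□-free b)
schema-□-free (a ⩔ b) = bf-∨ (schema-□-free a) (schema-□-free b)
schema-□-free (∼ a) = bf-¬ (schema-□-free a)

evalB-schema : ∀ {n} V (a : BF n) →
               evalB V (schema a) ≡ evalBF (Vec.tabulate (V ∘ toℕ)) a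
evalB-schema V (var i)
  rewrite lookup∘tabulate (pₘ ∘ toℕ) i | lookup∘tabulate (V ∘ toℕ) i = refl
evalB-schema V ⊥ᵇ = refl
evalB-schema V ⊤ᵇ = refl
evalB-schema V (a ⩓ b) = cong₂ B._∧_ (evalB-schema V a) (evalB-schema V b)
evalB-schema V (a ⩔ b) = cong₂ B._∨_ (evalB-schema V a) (evalB-schema V b)
evalB-schema V (∼ a) = cong B.not (evalB-schema V a)

assign : ∀ {n} → Vec MFm n → ℕ → MFm
assign [] k = ⊤ₘ
assign (φ ∷ ρ) zero = φ
assign (φ ∷ ρ) (suc k) = assign ρ k

assign-toℕ : ∀ {n} (ρ : Vec MFm n) i → assign ρ (toℕ i) ≡ Vec.lookup ρ i
assign-toℕ (φ ∷ ρ) fz = refl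
assign-toℕ (φ ∷ ρ) (fs i) = assign-toℕ ρ i

subst-schema : ∀ {n} (a : BF n) ρ → substM (assign ρ) (schema a) ≡ ⟪ a ⟫ ρ
subst-schema (var i) ρ
  rewrite lookup∘tabulate (pₘ ∘ toℕ) i = assign-toℕ ρ i
subst-schema ⊥ᵇ ρ = refl
subst-schema ⊤ᵇ ρ = refl
subst-schema (a ⩓ b) ρ = cong₂ _∧ₘ_ (subst-schema a ρ) (subst-schema b ρ)
subst-schema (a ⩔ b) ρ = cong₂ _∨ₘ_ (subst-schema a ρ) (subst-schema b ρ)
subst-schema (∼ a) ρ = cong ¬ₘ (subst-schema a ρ)

-- `Taut` admits □-free formulas only, so the schema is derived for propositional variables and the
-- modal formulas in `ρ` are substituted afterwards.
tautology : ∀ {n} (a : BF n) → Valid a → ∀ ρ → GL (⟪ a ⟫ ρ)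
tautology {n} a h ρ = subst GL (subst-schema a ρ) (sub (assign ρ) (taut
  (schema-□-free a , λ V → trans (evalB-schema V a)
    (Equivalence.to T-≡ (allVec-sound n _ h (Vec.tabulate (V ∘ toℕ)))))))

x₀ : ∀ {n} → BF (suc n)
x₀ = var fz
x₁ : ∀ {n} → BF (suc (suc n))
x₁ = var (fs fz)
x₂ : ∀ {n} → BF (suc (suc (suc n)))
x₂ = var (fs (fs fz))
x₃ : ∀ {n} → BF (suc (suc (suc (suc n))))
x₃ = var (fs (fs (fs fz)))
x₄ : ∀ {n} → BF (suc (suc (suc (suc (suc n)))))
x₄ = var (fs (fs (fs (fs fz))))
x₅ : ∀ {n} → BF (suc (suc (suc (suc (suc (suc n))))))
x₅ = var (fs (fs (fs (fs (fs fz)))))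

taut₁ : (f : BF 1 → BF 1) {_ : Valid (f x₀)} →
        ∀ {a} → GL (⟪ f x₀ ⟫ (a ∷ []))
taut₁ f {h} {a} = tautology (f x₀) h (a ∷ [])

taut₂ : (f : BF 2 → BF 2 → BF 2) {_ : Valid (f x₀ x₁)} →
        ∀ {a b} → GL (⟪ f x₀ x₁ ⟫ (a ∷ b ∷ []))
taut₂ f {h} {a} {b} = tautology (f x₀ x₁) h (a ∷ b ∷ [])

taut₃ : (f : BF 3 → BF 3 → BF 3 → BF 3) {_ : Valid (f x₀ x₁ x₂)} →
        ∀ {a b c} → GL (⟪ f x₀ x₁ x₂ ⟫ (a ∷ b ∷ c ∷ []))
taut₃ f {h} {a} {b} {c} = tautology (f x₀ x₁ x₂) h (a ∷ b ∷ c ∷ [])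

taut₄ : (f : BF 4 → BF 4 → BF 4 → BF 4 → BF 4) {_ : Valid (f x₀ x₁ x₂ x₃)} →
        ∀ {a b c d} → GL (⟪ f x₀ x₁ x₂ x₃ ⟫ (a ∷ b ∷ c ∷ d ∷ []))
taut₄ f {h} {a} {b} {c} {d} = tautology (f x₀ x₁ x₂ x₃) h (a ∷ b ∷ c ∷ d ∷ [])

taut₅ : (f : BF 5 → BF 5 → BF 5 → BF 5 → BF 5 → BF 5)
        {_ : Valid (f x₀ x₁ x₂ x₃ x₄)} →
        ∀ {a b c d e} → GL (⟪ f x₀ x₁ x₂ x₃ x₄ ⟫ (a ∷ b ∷ c ∷ d ∷ e ∷ []))
taut₅ f {h} {a} {b} {c} {d} {e} =
  tautology (f x₀ x₁ x₂ x₃ x₄) h (a ∷ b ∷ c ∷ d ∷ e ∷ [])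

taut₆ : (f : BF 6 → BF 6 → BF 6 → BF 6 → BF 6 → BF 6 → BF 6)
        {_ : Valid (f x₀ x₁ x₂ x₃ x₄ x₅)} →
        ∀ {a b c d e g} →
        GL (⟪ f x₀ x₁ x₂ x₃ x₄ x₅ ⟫ (a ∷ b ∷ c ∷ d ∷ e ∷ g ∷ []))
taut₆ f {h} {a} {b} {c} {d} {e} {g} =
  tautology (f x₀ x₁ x₂ x₃ x₄ x₅) h (a ∷ b ∷ c ∷ d ∷ e ∷ g ∷ [])

-- Derived rules of GL

infixl 4 _⨾_

_⨾_ : ∀ {a b c} → GL (a →ₘ b) → GL (b →ₘ c) → GL (a →ₘ c)
d ⨾ e = taut₃ (λ a b c → (a ⇒ b) ⇒ (b ⇒ c) ⇒ a ⇒ c) · d · e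

↔-intro : ∀ {a b} → GL (a →ₘ b) → GL (b →ₘ a) → GL (a ↔ₘ b)
↔-intro d e = taut₂ (λ a b → a ⇒ b ⇒ a ⩓ b) · d · e

↔-to : ∀ {a b} → GL (a ↔ₘ b) → GL (a →ₘ b)
↔-to d = taut₂ (λ a b → (a ⇔ b) ⇒ a ⇒ b) · d

↔-from : ∀ {a b} → GL (a ↔ₘ b) → GL (b →ₘ a)
↔-from d = taut₂ (λ a b → (a ⇔ b) ⇒ b ⇒ a) · d

↔-refl : ∀ {a} → GL (a ↔ₘ a)
↔-refl = taut₁ (λ a → a ⇔ a)

↔-trans : ∀ {a b c} → GL (a ↔ₘ b) → GL (b ↔ₘ c) → GL (a ↔ₘ c)
↔-trans d e = taut₃ (λ a b c → (a ⇔ b) ⇒ (b ⇔ c) ⇒ (a ⇔ c)) · d · e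

∧-cong : ∀ {a b a' b'} → GL (a ↔ₘ a') → GL (b ↔ₘ b') → GL (a ∧ₘ b ↔ₘ a' ∧ₘ b')
∧-cong d e =
  taut₄ (λ a b a' b' → (a ⇔ a') ⇒ (b ⇔ b') ⇒ (a ⩓ b ⇔ a' ⩓ b')) · d · e

∨-cong : ∀ {a b a' b'} → GL (a ↔ₘ a') → GL (b ↔ₘ b') → GL (a ∨ₘ b ↔ₘ a' ∨ₘ b')
∨-cong d e =
  taut₄ (λ a b a' b' → (a ⇔ a') ⇒ (b ⇔ b') ⇒ (a ⩔ b ⇔ a' ⩔ b')) · d · e

¬-cong : ∀ {a a'} → GL (a ↔ₘ a') → GL (¬ₘ a ↔ₘ ¬ₘ a')
¬-cong d = taut₂ (λ a b → (a ⇔ b) ⇒ (∼ a ⇔ ∼ b)) · d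

□-K : ∀ {a b} → GL (□ (a →ₘ b) →ₘ □ a →ₘ □ b)
□-K {a} {b} = sub (assign (a ∷ b ∷ [])) kax

□-mono : ∀ {a b} → GL (a →ₘ b) → GL (□ a →ₘ □ b)
□-mono d = □-K · nec d

□-cong : ∀ {a b} → GL (a ↔ₘ b) → GL (□ a ↔ₘ □ b)
□-cong d = ↔-intro (□-mono (↔-to d)) (□-mono (↔-from d))

□-∧ : ∀ {a b} → GL (□ a →ₘ □ b →ₘ □ (a ∧ₘ b))
□-∧ = □-mono (taut₂ (λ a b → a ⇒ b ⇒ a ⩓ b)) ⨾ □-K

□-löb : ∀ {a} → GL (□ (□ a →ₘ a) →ₘ □ a)
□-löb {a} = sub (assign (a ∷ [])) (base löb)

-- Löb's axiom for a ∧ □ a.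
□-4 : ∀ {a} → GL (□ a →ₘ □ (□ a))
□-4 {a} = □-mono step ⨾ □-löb ⨾ □-mono (taut₂ (λ a b → a ⩓ b ⇒ b))
  where
  step : GL (a →ₘ □ (a ∧ₘ □ a) →ₘ a ∧ₘ □ a)
  step = taut₃ (λ a b c → (b ⇒ c) ⇒ a ⇒ b ⇒ a ⩓ c) ·
         □-mono (taut₂ (λ a b → a ⩓ b ⇒ a))

□⁺-intro : ∀ {a} → GL a → GL (□⁺ a)
□⁺-intro d = taut₂ (λ a b → a ⇒ b ⇒ a ⩓ b) · nec d · d

□⁺-elim : ∀ {a} → GL (□⁺ a →ₘ a)
□⁺-elim = taut₂ (λ a b → a ⩓ b ⇒ b)

□⁺-cong : ∀ {a b} → GL (a ↔ₘ b) → GL (□⁺ a ↔ₘ □⁺ b)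
□⁺-cong d = ∧-cong (□-cong d) d

-- Open formulas

Open : MFm → Set
Open a = GL (a →ₘ □ a)

∧-open : ∀ {a b} → Open a → Open b → Open (a ∧ₘ b)
∧-open d e = taut₅ (λ a b a' b' c → (a ⇒ a') ⇒ (b ⇒ b') ⇒ (a' ⇒ b' ⇒ c) ⇒ a ⩓ b ⇒ c)
             · d · e · □-∧

∨-open : ∀ {a b} → Open a → Open b → Open (a ∨ₘ b)
∨-open d e = taut₃ (λ a b c → (a ⇒ c) ⇒ (b ⇒ c) ⇒ a ⩔ b ⇒ c)
             · (d ⨾ □-mono (taut₂ (λ a b → a ⇒ a ⩔ b)))
             · (e ⨾ □-mono (taut₂ (λ a b → b ⇒ a ⩔ b)))

□⁺-open : ∀ {a} → Open (□⁺ a)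
□⁺-open = taut₄ (λ a b b' c → (b ⇒ b') ⇒ (b' ⇒ b ⇒ c) ⇒ b ⩓ a ⇒ c) · □-4 · □-∧

-- An open hypothesis persists to all later points, so whatever it implies can be boxed. This
-- introduces the `□⁺` in front of translated implications.
open-□⁺ : ∀ {a b} → Open a → GL (a →ₘ b) → GL (a →ₘ □⁺ b)
open-□⁺ d e = taut₃ (λ a b c → (a ⇒ b) ⇒ (a ⇒ c) ⇒ a ⇒ c ⩓ b) · e · (d ⨾ □-mono e)

open-fix : ∀ {a} → Open a → GL (a ↔ₘ □⁺ a)
open-fix d = ↔-intro (open-□⁺ d (taut₁ (λ a → a ⇒ a))) □⁺-elim

open-curry : ∀ {a b c} → Open a → Open b → GL (a ∧ₘ b →ₘ c) → GL (a →ₘ □⁺ (b →ₘ □⁺ c))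
open-curry d e g = open-□⁺ d (taut₃ (λ a b c → (a ⩓ b ⇒ c) ⇒ a ⇒ b ⇒ c)
                   · open-□⁺ (∧-open d e) g)

-- The translation T is sound for KM

-- Syntactic persistence: for variables and implications the outer `□⁺` is open, and for `⊠` the
-- claim is transitivity.
T-open : ∀ φ → Open (T φ)
T-open (pᵢ n) = □⁺-open
T-open ⊥ᵢ = taut₁ (λ a → ⊥ᵇ ⇒ a)
T-open ⊤ᵢ = taut₂ (λ a b → a ⇒ b ⇒ a) · nec (tautology ⊤ᵇ _ [])
T-open (φ ∧ᵢ ψ) = ∧-open (T-open φ) (T-open ψ)
T-open (φ ∨ᵢ ψ) = ∨-open (T-open φ) (T-open ψ)
T-open (φ →ᵢ ψ) = □⁺-open
T-open (⊠ φ) = □-4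

-- Commutation holds only up to GL: the right side puts an extra `□⁺` in front of each `T (s n)`,
-- and openness of translations removes it.
T-subst : ∀ s φ → GL (T (substI s φ) ↔ₘ substM (T ∘ s) (T φ))
T-subst s (pᵢ n) = open-fix (T-open (s n))
T-subst s ⊥ᵢ = ↔-refl
T-subst s ⊤ᵢ = ↔-refl
T-subst s (φ ∧ᵢ ψ) = ∧-cong (T-subst s φ) (T-subst s ψ)
T-subst s (φ ∨ᵢ ψ) = ∨-cong (T-subst s φ) (T-subst s ψ)
T-subst s (φ →ᵢ ψ) = □⁺-cong (∨-cong (¬-cong (T-subst s φ)) (T-subst s ψ))
T-subst s (⊠ φ) = □-cong (T-subst s φ)

T-mp : ∀ φ ψ → GL (T (φ →ᵢ ψ) →ₘ T φ →ₘ T ψ)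
T-mp φ ψ = □⁺-elim

T-IPCKAx : ∀ {φ} → IPCKAx φ → GL (T φ)
T-IPCKAx ax1 = □⁺-intro (open-□⁺ □⁺-open (taut₂ (λ a b → a ⇒ b ⇒ a)))
T-IPCKAx ax2 = □⁺-intro (open-curry □⁺-open □⁺-open (open-□⁺ (∧-open □⁺-open □⁺-open)
  (taut₆ (λ P Q R u v w → (u ⩓ (P ⇒ v ⩓ (Q ⇒ R))) ⩓ (w ⩓ (P ⇒ Q)) ⇒ P ⇒ R)) ⨾ □⁺-elim))
T-IPCKAx ax3 = □⁺-intro (taut₂ (λ a b → a ⩓ b ⇒ a))
T-IPCKAx ax4 = □⁺-intro (taut₂ (λ a b → a ⩓ b ⇒ b))
T-IPCKAx ax5 = □⁺-intro (open-□⁺ □⁺-open (taut₂ (λ a b → a ⇒ b ⇒ a ⩓ b)))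
T-IPCKAx ax6 = □⁺-intro (taut₂ (λ a b → a ⇒ a ⩔ b))
T-IPCKAx ax7 = □⁺-intro (taut₂ (λ a b → b ⇒ a ⩔ b))
T-IPCKAx ax8 = □⁺-intro (open-curry □⁺-open □⁺-open (open-□⁺ (∧-open □⁺-open □⁺-open)
  (taut₅ (λ P Q R u v → (u ⩓ (P ⇒ R)) ⩓ (v ⩓ (Q ⇒ R)) ⇒ P ⩔ Q ⇒ R)) ⨾ □⁺-elim))
T-IPCKAx ax9 = □⁺-intro (taut₁ (λ a → ⊥ᵇ ⇒ a))
T-IPCKAx ax10 = tautology ⊤ᵇ _ []
T-IPCKAx axK = □⁺-intro (open-□⁺ □-4 (□-mono □⁺-elim ⨾ □-K))

T-KMAx : ∀ {φ} → KMAx φ → GL (T φ)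
T-KMAx km1 = □⁺-intro □⁺-open
-- The first conjunct of `□⁺ (□ P → P)` yields `□ P` by Löb's axiom, and the second then yields `P`.
T-KMAx km2 = □⁺-intro (taut₃ (λ a b c → (a ⇒ b) ⇒ a ⩓ (b ⇒ c) ⇒ c) · □-löb)
-- Strictly above, `Q → P` follows from `□ P`; at the point itself classical logic chooses between
-- `Q` and `Q → P`.
T-KMAx km3 = □⁺-intro (taut₄ (λ u P Q w → (u ⇒ w) ⇒ u ⇒ Q ⩔ (w ⩓ (Q ⇒ P)))
  · □-mono (taut₂ (λ P Q → P ⇒ Q ⇒ P)))

T-sound : ∀ {φ} → KM φ → GL (T φ)
T-sound (base h) = T-KMAx h
T-sound (ipck h) = T-IPCKAx h
T-sound (sub s {φ} d) = ↔-from (T-subst s φ) · sub (T ∘ s) (T-sound d)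
T-sound (mp {φ} {ψ} d e) = T-mp φ ψ · T-sound e · T-sound d
T-sound (nec d) = nec (T-sound d)

-- Intuitionistic derivations

infix 3 _≤_

_≤_ : IFm → IFm → Set
a ≤ b = KM (a →ᵢ b)

assignᵢ : IFm → IFm → IFm → ℕ → IFm
assignᵢ a b c 0 = a
assignᵢ a b c 1 = b
assignᵢ a b c (suc (suc _)) = c

const : ∀ {a b} → KM b → a ≤ b
const {a} {b} d = mp d (sub (assignᵢ b a a) (ipck ax1))

ap : ∀ {x a b} → x ≤ a →ᵢ b → x ≤ a → x ≤ b
ap {x} {a} {b} d e = mp e (mp d (sub (assignᵢ x a b) (ipck ax2)))

≤-refl : ∀ {a} → a ≤ a
≤-refl {a} = ap {a = a →ᵢ a} (sub (assignᵢ a (a →ᵢ a) a) (ipck ax1))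
                             (sub (assignᵢ a a a) (ipck ax1))

≤-trans : ∀ {a b c} → a ≤ b → b ≤ c → a ≤ c
≤-trans d e = ap (const e) d

∧≤ˡ : ∀ {a b} → a ∧ᵢ b ≤ a
∧≤ˡ {a} {b} = sub (assignᵢ a b a) (ipck ax3)

∧≤ʳ : ∀ {a b} → a ∧ᵢ b ≤ b
∧≤ʳ {a} {b} = sub (assignᵢ a b a) (ipck ax4)

≤∧ : ∀ {x a b} → x ≤ a → x ≤ b → x ≤ a ∧ᵢ b
≤∧ {x} {a} {b} d e = ap (≤-trans d (sub (assignᵢ a b a) (ipck ax5))) e

≤∨ˡ : ∀ {a b} → a ≤ a ∨ᵢ b
≤∨ˡ {a} {b} = sub (assignᵢ a b a) (ipck ax6)

≤∨ʳ : ∀ {a b} → b ≤ a ∨ᵢ b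
≤∨ʳ {a} {b} = sub (assignᵢ a b a) (ipck ax7)

∨≤ : ∀ {a b c} → a ≤ c → b ≤ c → a ∨ᵢ b ≤ c
∨≤ {a} {b} {c} d e = mp e (mp d (sub (assignᵢ a b c) (ipck ax8)))

⊥≤ : ∀ {a} → ⊥ᵢ ≤ a
⊥≤ {a} = sub (assignᵢ a a a) (ipck ax9)

≤⊤ : ∀ {a} → a ≤ ⊤ᵢ
≤⊤ = const (ipck ax10)

curry : ∀ {x a b} → x ∧ᵢ a ≤ b → x ≤ a →ᵢ b
curry {x} {a} {b} d = ≤-trans (sub (assignᵢ x a a) (ipck ax5))
  (mp (const d) (sub (assignᵢ a (x ∧ᵢ a) b) (ipck ax2)))

swap : ∀ {x a b} → a ≤ x →ᵢ b → x ≤ a →ᵢ b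
swap d = curry (ap (≤-trans ∧≤ʳ d) ∧≤ˡ)

-- The cut rule for the sequent x ⊢ y; both disjuncts lie below `x → y`. It stands in for excluded
-- middle, since `a` may be assumed on either side.
∧-cut : ∀ {x a y} → x ≤ y ∨ᵢ a → x ∧ᵢ a ≤ y → x ≤ y
∧-cut d e = ap (≤-trans d (∨≤ (curry ∧≤ˡ) (swap (curry e)))) ≤-refl

∧-mono : ∀ {a b a' b'} → a ≤ a' → b ≤ b' → a ∧ᵢ b ≤ a' ∧ᵢ b'
∧-mono d e = ≤∧ (≤-trans ∧≤ˡ d) (≤-trans ∧≤ʳ e)

∨-mono : ∀ {a b a' b'} → a ≤ a' → b ≤ b' → a ∨ᵢ b ≤ a' ∨ᵢ b'
∨-mono d e = ∨≤ (≤-trans d ≤∨ˡ) (≤-trans e ≤∨ʳ)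

⊠-K : ∀ {a b} → ⊠ (a →ᵢ b) ≤ ⊠ a →ᵢ ⊠ b
⊠-K {a} {b} = sub (assignᵢ a b a) (ipck axK)

⊠-mono : ∀ {a b} → a ≤ b → ⊠ a ≤ ⊠ b
⊠-mono d = mp (nec d) ⊠-K

≤⊠ : ∀ {a} → a ≤ ⊠ a
≤⊠ {a} = sub (assignᵢ a a a) (base km1)

⊠-löb : ∀ {a} → ⊠ a →ᵢ a ≤ a
⊠-löb {a} = sub (assignᵢ a a a) (base km2)

⊠-split : ∀ {a b} → ⊠ a ≤ b ∨ᵢ (b →ᵢ a)
⊠-split {a} {b} = sub (assignᵢ a b a) (base km3)

-- Clausal forms of modal formulas

-- The clause (a , b) stands for ¬ T a ∨ T b, and a list of clauses for their
-- conjunction: up to provable equivalence, the Boolean combinations of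
-- translations.
Clause CNF : Set
Clause = IFm × IFm
CNF = List Clause

_∨ᶜ_ : Clause → Clause → Clause
(a , b) ∨ᶜ (a' , b') = a ∧ᵢ a' , b ∨ᵢ b'

infixr 5 _⊗_

_⊗_ : CNF → CNF → CNF
_⊗_ = cartesianProductWith _∨ᶜ_

lit : IFm → CNF
lit a = (⊤ᵢ , a) ∷ []

negᶜ : Clause → CNF
negᶜ (a , b) = (⊤ᵢ , a) ∷ (b , ⊥ᵢ) ∷ []

neg : CNF → CNF
neg [] = lit ⊥ᵢ
neg (κ ∷ C) = negᶜ κ ⊗ neg C

-- T (int C) is □⁺ of the formula that C stands for (T-int below).
int : CNF → IFm
int [] = ⊤ᵢ
int ((a , b) ∷ C) = (a →ᵢ b) ∧ᵢ int C

cnf : (ℕ → CNF) → MFm → CNF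
cnf c (pₘ n) = c n
cnf c ⊥ₘ = lit ⊥ᵢ
cnf c ⊤ₘ = []
cnf c (φ ∧ₘ ψ) = cnf c φ ++ cnf c ψ
cnf c (φ ∨ₘ ψ) = cnf c φ ⊗ cnf c ψ
cnf c (¬ₘ φ) = neg (cnf c φ)
cnf c (□ φ) = lit (⊠ (int (cnf c φ)))

cnf-subst : ∀ c s φ → cnf c (substM s φ) ≡ cnf (cnf c ∘ s) φ
cnf-subst c s (pₘ n) = refl
cnf-subst c s ⊥ₘ = refl
cnf-subst c s ⊤ₘ = refl
cnf-subst c s (φ ∧ₘ ψ) = cong₂ _++_ (cnf-subst c s φ) (cnf-subst c s ψ)
cnf-subst c s (φ ∨ₘ ψ) = cong₂ _⊗_ (cnf-subst c s φ) (cnf-subst c s ψ)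
cnf-subst c s (¬ₘ φ) = cong neg (cnf-subst c s φ)
cnf-subst c s (□ φ) = cong (lit ∘ ⊠ ∘ int) (cnf-subst c s φ)

-- A pair x , y is read as the hypothesis that x is true and y is false, under
-- which x ≤ y expresses absurdity; True and False are strong enough to be
-- decided clause by clause once the pair has been refined.
True False : IFm → IFm → Clause → Set
True x y (a , b) = (a ≤ y) ⊎ (x ≤ b)
False x y (a , b) = (x ≤ a) × (b ≤ y)

Val : IFm → IFm → Bool → CNF → Set
Val x y true C = All (True x y) C
Val x y false C = Any (False x y) C

True-mono : ∀ {x y x' y'} → x' ≤ x → y ≤ y' → ∀ {κ} → True x y κ → True x' y' κ
True-mono d e (inj₁ h) = inj₁ (≤-trans h e)
True-mono d e (inj₂ h) = inj₂ (≤-trans d h)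

False-mono : ∀ {x y x' y'} → x' ≤ x → y ≤ y' → ∀ {κ} → False x y κ → False x' y' κ
False-mono d e (h , k) = ≤-trans d h , ≤-trans k e

Val-mono : ∀ {x y x' y'} → x' ≤ x → y ≤ y' → ∀ {b C} → Val x y b C → Val x' y' b C
Val-mono d e {true} = All.map (True-mono d e)
Val-mono d e {false} = Any.map (False-mono d e)

Val-conflict : ∀ {x y C} → Val x y true C → Val x y false C → x ≤ y
Val-conflict (inj₁ d ∷ _) (here (e , _)) = ≤-trans e d
Val-conflict (inj₂ d ∷ _) (here (_ , e)) = ≤-trans d e
Val-conflict (_ ∷ ts) (there f) = Val-conflict ts f

-- Cut on `a`, then on `b`. The clause becomes true when `a` joins the right side or `b` the left,
-- and false when `a` joins the left and `b` the right: excluded middle for a clause, paid for by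
-- refining the pair.
split-clause : ∀ {x y} κ →
  (∀ {x' y'} → x' ≤ x → y ≤ y' → True x' y' κ → x' ≤ y') →
  (∀ {x' y'} → x' ≤ x → y ≤ y' → False x' y' κ → x' ≤ y') → x ≤ y
split-clause (a , b) t f =
  ∧-cut (t ≤-refl ≤∨ˡ (inj₁ ≤∨ʳ))
        (∧-cut (f ∧≤ˡ ≤∨ˡ (∧≤ʳ , ≤∨ʳ))
               (≤-trans (∧-mono ∧≤ˡ ≤-refl) (t ∧≤ˡ ≤-refl (inj₂ ∧≤ʳ))))

split : ∀ {x y} C →
  (∀ {x' y'} → x' ≤ x → y ≤ y' → ∀ b → Val x' y' b C → x' ≤ y') → x ≤ y
split [] h = h ≤-refl ≤-refl true []
split (κ ∷ C) h = split-clause κ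
  (λ d e t → split C λ
    { d' e' true v → h (≤-trans d' d) (≤-trans e e') true (True-mono d' e' t ∷ v)
    ; d' e' false v → h (≤-trans d' d) (≤-trans e e') false (there v) })
  (λ d e f → h d e false (here f))

Val-++ : ∀ {x y} b b' {C D} → Val x y b C → Val x y b' D → Val x y (b B.∧ b') (C ++ D)
Val-++ true true u v = Allₚ.++⁺ u v
Val-++ true false {C} u v = Anyₚ.++⁺ʳ C v
Val-++ false b' u v = Anyₚ.++⁺ˡ u

True-∨ˡ : ∀ {x y} κ κ' → True x y κ → True x y (κ ∨ᶜ κ')
True-∨ˡ κ κ' (inj₁ d) = inj₁ (≤-trans ∧≤ˡ d)
True-∨ˡ κ κ' (inj₂ d) = inj₂ (≤-trans d ≤∨ˡ)

True-∨ʳ : ∀ {x y} κ κ' → True x y κ' → True x y (κ ∨ᶜ κ')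
True-∨ʳ κ κ' (inj₁ d) = inj₁ (≤-trans ∧≤ʳ d)
True-∨ʳ κ κ' (inj₂ d) = inj₂ (≤-trans d ≤∨ʳ)

True-⊗ˡ : ∀ {x y C} → All (True x y) C → ∀ D → All (True x y) (C ⊗ D)
True-⊗ˡ [] D = []
True-⊗ˡ (_∷_ {κ} t ts) D =
  Allₚ.++⁺ (Allₚ.map⁺ (All.universal (λ κ' → True-∨ˡ κ κ' t) D)) (True-⊗ˡ ts D)

True-⊗ʳ : ∀ {x y} C {D} → All (True x y) D → All (True x y) (C ⊗ D)
True-⊗ʳ [] ts = []
True-⊗ʳ (κ ∷ C) ts =
  Allₚ.++⁺ (Allₚ.map⁺ (All.map (λ {κ'} → True-∨ʳ κ κ') ts)) (True-⊗ʳ C ts)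

Val-⊗ : ∀ {x y} b b' {C D} → Val x y b C → Val x y b' D → Val x y (b B.∨ b') (C ⊗ D)
Val-⊗ true b' {D = D} u v = True-⊗ˡ u D
Val-⊗ false true {C} u v = True-⊗ʳ C v
Val-⊗ false false u v =
  Anyₚ.cartesianProductWith⁺ _∨ᶜ_ (λ (d , e) (d' , e') → ≤∧ d d' , ∨≤ e e') u v

Val-neg : ∀ {x y} b {C} → Val x y b C → Val x y (B.not b) (neg C)
Val-neg true [] = here (≤⊤ , ⊥≤)
Val-neg true {κ ∷ C} (inj₁ d ∷ ts) =
  Val-⊗ false false {negᶜ κ} (here (≤⊤ , d)) (Val-neg true ts)
Val-neg true {κ ∷ C} (inj₂ d ∷ ts) =
  Val-⊗ false false {negᶜ κ} (there (here (d , ⊥≤))) (Val-neg true ts)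
Val-neg false {_ ∷ C} (here (d , e)) = True-⊗ˡ (inj₂ d ∷ inj₁ e ∷ []) (neg C)
Val-neg false {κ ∷ C} (there f) = True-⊗ʳ (negᶜ κ) (Val-neg false f)

-- An exclusive bound on the variables; tautologies are checked by deciding finitely many of them.
bound : MFm → ℕ
bound (pₘ n) = suc n
bound ⊥ₘ = 0
bound ⊤ₘ = 0
bound (φ ∧ₘ ψ) = bound φ ⊔ bound ψ
bound (φ ∨ₘ ψ) = bound φ ⊔ bound ψ
bound (¬ₘ φ) = bound φ
bound (□ φ) = bound φ

Val-cnf : ∀ {x y m} {V : ℕ → Bool} c → (∀ {k} → k < m → Val x y (V k) (c k)) →
          ∀ {φ} → □-free φ → bound φ ℕ.≤ m → Val x y (evalB V φ) (cnf c φ)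
Val-cnf c h (bf-var k) le = h le
Val-cnf c h bf-⊥ le = here (≤⊤ , ⊥≤)
Val-cnf c h bf-⊤ le = []
Val-cnf c h (bf-∧ {φ} {ψ} f g) le =
  Val-++ _ _ (Val-cnf c h f (m⊔n≤o⇒m≤o (bound φ) _ le))
             (Val-cnf c h g (m⊔n≤o⇒n≤o (bound φ) _ le))
Val-cnf c h (bf-∨ {φ} {ψ} f g) le =
  Val-⊗ _ _ (Val-cnf c h f (m⊔n≤o⇒m≤o (bound φ) _ le))
            (Val-cnf c h g (m⊔n≤o⇒n≤o (bound φ) _ le))
Val-cnf c h (bf-¬ f) le = Val-neg _ (Val-cnf c h f le)

split-below : ∀ {x y} m (c : ℕ → CNF) →
  (∀ {x' y'} → x' ≤ x → y ≤ y' → ∀ (V : ℕ → Bool) →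
     (∀ {k} → k < m → Val x' y' (V k) (c k)) → x' ≤ y') →
  x ≤ y
split-below zero c h = h ≤-refl ≤-refl (λ _ → false) λ ()
split-below (suc m) c h = split (c 0) λ d e b u →
  split-below m (c ∘ suc) λ d' e' V v →
    h (≤-trans d' d) (≤-trans e e') (λ { zero → b ; (suc k) → V k })
      λ { {zero} _ → Val-mono d' e' u ; {suc k} (s≤s lt) → v lt }

-- Proof by refutation: a clause `(a , b)` is tested on the pair `θ ∧ a`, `b`, which makes it false.
≤int : ∀ {θ} C → (∀ {x y} → x ≤ θ → Val x y false C → x ≤ y) → θ ≤ int C
≤int [] h = ≤⊤
≤int ((a , b) ∷ C) h =
  ≤∧ (curry (h ∧≤ˡ (here (∧≤ʳ , ≤-refl)))) (≤int C λ d f → h d (there f))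

int-false : ∀ {x y C} → Val x y false C → x ≤ int C → x ≤ y
int-false (here (d , e)) h = ≤-trans (ap (≤-trans h ∧≤ˡ) d) e
int-false (there f) h = int-false f (≤-trans h ∧≤ʳ)

-- Assume `D` false and split on `C`: if `C` is true, the implication is false, and if `C` is false,
-- its interior is contradicted.
int-mp : ∀ {θ} C D → θ ≤ int C → θ ≤ int (neg C ⊗ D) → θ ≤ int D
int-mp C D d e = ≤int D λ h f → split C λ
  { h' k' true v → int-false (Val-⊗ false false (Val-neg true v) (Val-mono h' k' f))
                             (≤-trans h' (≤-trans h e))
  ; h' k' false v → int-false v (≤-trans h' (≤-trans h d)) }

lit-true : ∀ {x y a} → Val x y true (lit a) → a ≤ y → x ≤ y
lit-true (inj₁ d ∷ []) e = ≤-trans ≤⊤ d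
lit-true (inj₂ d ∷ []) e = ≤-trans d e

int-lit : ∀ {θ a} → θ ≤ a → θ ≤ int (lit a)
int-lit d = ≤int _ λ { h (here (_ , e)) → ≤-trans h (≤-trans d e) }

-- A literal is open, hence may join the persistent hypothesis `θ`. For a general `C` in its place,
-- `int C` would be too strong an assumption.
int-deduction : ∀ {θ a} D → θ ∧ᵢ a ≤ int D → θ ≤ int (neg (lit a) ⊗ D)
int-deduction {θ} {a} D d = ≤int _ λ h f → split (lit a) λ
  { h' k' true v → lemma (≤-trans h' h) v (Val-mono h' k' f)
  ; h' k' false v → Val-conflict (True-⊗ˡ (Val-neg false v) D) (Val-mono h' k' f) }
  where
  lemma : ∀ {x y} → x ≤ θ → Val x y true (lit a) → Val x y false (neg (lit a) ⊗ D) → x ≤ y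
  lemma h (inj₁ v ∷ []) f = ≤-trans ≤⊤ v
  lemma h (inj₂ v ∷ []) f = split D λ
    { h' k' true u → Val-conflict (True-⊗ʳ (neg (lit a)) u) (Val-mono h' k' f)
    ; h' k' false u → int-false u (≤-trans h' (≤-trans (≤∧ h v) d)) }

-- If some clause were false, deciding every variable of `φ` would refine the pair to one on which
-- the truth table makes `φ` true as well.
int-taut : ∀ {φ} → Taut φ → ∀ c → KM (int (cnf c φ))
int-taut {φ} (bf , tv) c = mp (ipck ax10) (≤int (cnf c φ) λ _ f →
  split-below (bound φ) c λ {x'} {y'} d e V v →
    Val-conflict (subst (λ b → Val x' y' b (cnf c φ)) (tv V) (Val-cnf c v bf ℕₚ.≤-refl))
                 (Val-mono d e f))

-- Quantifying over all `c` makes the substitution rule immediate: a substitution only changes the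
-- clausal values of the variables.
cnf-sound : ∀ {φ} → GL φ → ∀ c → KM (int (cnf c φ))
-- The interior of the reading of □p → p lies below `⊠ (int C) → int C`, to which `km2` applies.
cnf-sound (base löb) c = mp (ipck ax10) (int-deduction _ (int-lit (≤-trans ∧≤ʳ (⊠-mono
  (≤-trans (curry (int-mp (lit (⊠ (int C))) C (int-lit ∧≤ʳ) ∧≤ˡ)) ⊠-löb)))))
  where C = c 0
cnf-sound (taut h) c = int-taut h c
cnf-sound kax c = mp (ipck ax10) (int-deduction _ (int-deduction _ (int-lit
  (ap (≤-trans (≤-trans ∧≤ˡ ∧≤ʳ) (≤-trans (⊠-mono (curry (int-mp (c 0) (c 1) ∧≤ʳ ∧≤ˡ))) ⊠-K))
      ∧≤ʳ))))
cnf-sound (sub s {φ} d) c =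
  subst (KM ∘ int) (sym (cnf-subst c s φ)) (cnf-sound d (cnf c ∘ s))
cnf-sound (mp {φ} {ψ} d e) c = mp (ipck ax10)
  (int-mp (cnf c φ) (cnf c ψ) (const (cnf-sound d c)) (const (cnf-sound e c)))
cnf-sound (nec {φ} d) c = mp (ipck ax10) (int-lit (const (nec (cnf-sound d c))))

-- Equivalence of C with lit a.
record Rep (C : CNF) (a : IFm) : Set where
  field
    upper : ∀ {x y} → Val x y true C → a ≤ y → x ≤ y
    lower : ∀ {x y} → Val x y false C → x ≤ a → x ≤ y

open Rep

Rep-≤int : ∀ {C a} → Rep C a → a ≤ int C
Rep-≤int {C} R = ≤int C λ d f → lower R f d

Rep-int≤ : ∀ {C a} → Rep C a → int C ≤ a
Rep-int≤ {C} R = split C λ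
  { d e true v → upper R v e ; d e false v → int-false v d }

Rep-resp : ∀ {C a a'} → a ≤ a' → a' ≤ a → Rep C a → Rep C a'
Rep-resp d e R .upper v h = upper R v (≤-trans d h)
Rep-resp d e R .lower v h = lower R v (≤-trans h e)

Rep-lit : ∀ a → Rep (lit a) a
Rep-lit a .upper = lit-true
Rep-lit a .lower (here (_ , e)) h = ≤-trans h e

Rep-⊤ : Rep [] ⊤ᵢ
Rep-⊤ .upper _ h = ≤-trans ≤⊤ h
Rep-⊤ .lower () _

upper-∨ : ∀ {C a} → Rep C a → ∀ {x y} → Val x y true C → x ≤ y ∨ᵢ a
upper-∨ R v = upper R (Val-mono ≤-refl ≤∨ˡ v) ≤∨ʳ

lower-∧ : ∀ {C a} → Rep C a → ∀ {x y} → Val x y false C → x ∧ᵢ a ≤ y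
lower-∧ R f = lower R (Val-mono ∧≤ˡ ≤-refl f) ∧≤ʳ

Rep-∧ : ∀ {C D a b} → Rep C a → Rep D b → Rep (C ++ D) (a ∧ᵢ b)
Rep-∧ {C} R S .upper v h with Allₚ.++⁻ C v
... | u , w = ∧-cut (upper-∨ R u)
  (∧-cut (≤-trans ∧≤ˡ (upper-∨ S w)) (≤-trans (≤∧ (≤-trans ∧≤ˡ ∧≤ʳ) ∧≤ʳ) h))
Rep-∧ {C} R S .lower v h with Anyₚ.++⁻ C v
... | inj₁ f = lower R f (≤-trans h ∧≤ˡ)
... | inj₂ f = lower S f (≤-trans h ∧≤ʳ)

Rep-∨ : ∀ {C D a b} → Rep C a → Rep D b → Rep (C ⊗ D) (a ∨ᵢ b)
Rep-∨ {C} {D} R S .upper v h = split C λ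
  { d e true u → upper R u (≤-trans (≤-trans ≤∨ˡ h) e)
  ; d e false u → split D λ
    { d' e' true w → upper S w (≤-trans (≤-trans ≤∨ʳ h) (≤-trans e e'))
    ; d' e' false w → Val-conflict (Val-mono (≤-trans d' d) (≤-trans e e') v)
        (Val-⊗ false false (Val-mono d' e' u) w) } }
Rep-∨ {C} {D} R S .lower v h = split C λ
  { d e true u → Val-conflict (True-⊗ˡ u D) (Val-mono d e v)
  ; d e false u → split D λ
    { d' e' true w → Val-conflict (True-⊗ʳ C w) (Val-mono (≤-trans d' d) (≤-trans e e') v)
    ; d' e' false w → ap (≤-trans (≤-trans d' (≤-trans d h))
        (∨≤ (swap (curry (lower-∧ R (Val-mono d' e' u)))) (swap (curry (lower-∧ S w))))) ≤-refl } }

≤∨∧ : ∀ {x y a b} → x ≤ y ∨ᵢ a → x ≤ y ∨ᵢ b → x ≤ y ∨ᵢ (a ∧ᵢ b)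
≤∨∧ d e = ∧-cut (≤-trans d (∨-mono ≤∨ˡ ≤-refl))
  (∧-cut (≤-trans ∧≤ˡ (≤-trans e (∨-mono ≤∨ˡ ≤-refl)))
         (≤-trans (≤∧ (≤-trans ∧≤ˡ ∧≤ʳ) ∧≤ʳ) ≤∨ʳ))

-- The axiom ⊠p → q ∨ (q → p) makes ⊠ (int C) decide every clause of C.
⊠int-decides : ∀ {x y} C → x ≤ ⊠ (int C) → Val x y true C → x ≤ y ∨ᵢ int C
⊠int-decides [] d [] = ≤-trans ≤⊤ ≤∨ʳ
⊠int-decides ((a , b) ∷ C) d (t ∷ v) =
  ≤∨∧ (clause t) (⊠int-decides C (≤-trans d (⊠-mono ∧≤ʳ)) v)
  where
  clause : True _ _ (a , b) → _ ≤ _ ∨ᵢ (a →ᵢ b)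
  clause (inj₁ e) = ≤-trans d (≤-trans (⊠-mono ∧≤ˡ) (≤-trans ⊠-split
    (∨-mono e (curry (ap (ap ∧≤ˡ ∧≤ʳ) ∧≤ʳ)))))
  clause (inj₂ e) = ≤-trans (curry (≤-trans ∧≤ˡ e)) ≤∨ʳ

-- The list is the clausal form of `□⁺` of `C`, so every `□⁺` has an intuitionistic value. `km3`
-- enters through `upper`, `km1` through `lower`.
Rep-int : ∀ C → Rep (lit (⊠ (int C)) ++ C) (int C)
Rep-int C .upper (inj₁ d ∷ _) h = ≤-trans ≤⊤ d
Rep-int C .upper (inj₂ d ∷ v) h = ≤-trans (⊠int-decides C d v) (∨≤ ≤-refl h)
Rep-int C .lower (here (_ , e)) h = ≤-trans (≤-trans h ≤⊠) e
Rep-int C .lower (there f) h = int-false f h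

-- The list is the clausal value of a translated implication. `Rep-int` represents it by its
-- interior, which remains to be compared with `a → b`.
Rep-→ : ∀ {C D a b} → Rep C a → Rep D b →
        Rep (lit (⊠ (int (neg C ⊗ D))) ++ (neg C ⊗ D)) (a →ᵢ b)
Rep-→ {C} {D} {a} {b} R S = Rep-resp (curry fw) bw (Rep-int (neg C ⊗ D))
  where
  fw : int (neg C ⊗ D) ∧ᵢ a ≤ b
  fw = ≤-trans (int-mp C D (≤-trans ∧≤ʳ (Rep-≤int R)) ∧≤ˡ) (Rep-int≤ S)

  bw : a →ᵢ b ≤ int (neg C ⊗ D)
  bw = ≤int _ λ h f → split C λ
    { d e true u → split D λ
      { d' e' true w → Val-conflict (True-⊗ʳ (neg C) w)
                                    (Val-mono (≤-trans d' d) (≤-trans e e') f)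
      ; d' e' false w → ∧-cut (upper-∨ R (Val-mono d' e' u))
          (lower S (Val-mono ∧≤ˡ ≤-refl w)
            (ap (≤-trans ∧≤ˡ (≤-trans d' (≤-trans d h))) ∧≤ʳ)) }
    ; d e false u → Val-conflict (True-⊗ˡ (Val-neg false u) D) (Val-mono d e f) }

-- Serves twice for ρ (σ L) ⊆ L: with `s` = `int ∘ c` it puts all readings of translations from L
-- into L, and with `s` = `pᵢ` it recovers a formula from its translation.
Rep-T : ∀ c s → (∀ n → Rep (cnf c (□⁺ (pₘ n))) (s n)) →
        ∀ φ → Rep (cnf c (T φ)) (substI s φ)
Rep-T c s h (pᵢ n) = h n
Rep-T c s h ⊥ᵢ = Rep-lit ⊥ᵢ
Rep-T c s h ⊤ᵢ = Rep-⊤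
Rep-T c s h (φ ∧ᵢ ψ) = Rep-∧ (Rep-T c s h φ) (Rep-T c s h ψ)
Rep-T c s h (φ ∨ᵢ ψ) = Rep-∨ (Rep-T c s h φ) (Rep-T c s h ψ)
Rep-T c s h (φ →ᵢ ψ) = Rep-→ (Rep-T c s h φ) (Rep-T c s h ψ)
Rep-T c s h (⊠ φ) =
  Rep-resp (⊠-mono (Rep-int≤ (Rep-T c s h φ))) (⊠-mono (Rep-≤int (Rep-T c s h φ)))
           (Rep-lit _)

-- Modal readings of clausal forms

embᶜ : Clause → MFm
embᶜ (a , b) = T a →ₘ T b

emb : CNF → MFm
emb [] = ⊤ₘ
emb (κ ∷ C) = embᶜ κ ∧ₘ emb C

emb-++ : ∀ C D → GL (emb (C ++ D) ↔ₘ emb C ∧ₘ emb D)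
emb-++ [] D = taut₁ (λ d → d ⇔ ⊤ᵇ ⩓ d)
emb-++ (κ ∷ C) D =
  taut₄ (λ k c d e → (e ⇔ c ⩓ d) ⇒ (k ⩓ e ⇔ (k ⩓ c) ⩓ d)) · emb-++ C D

emb-map : ∀ κ D → GL (emb (map (κ ∨ᶜ_) D) ↔ₘ embᶜ κ ∨ₘ emb D)
emb-map κ [] = taut₁ (λ k → ⊤ᵇ ⇔ k ⩔ ⊤ᵇ)
emb-map κ (κ' ∷ D) =
  taut₆ (λ a b a' b' d e → (e ⇔ (a ⇒ b) ⩔ d) ⇒
    ((a ⩓ a' ⇒ b ⩔ b') ⩓ e ⇔ (a ⇒ b) ⩔ ((a' ⇒ b') ⩓ d))) · emb-map κ D

emb-⊗ : ∀ C D → GL (emb (C ⊗ D) ↔ₘ emb C ∨ₘ emb D)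
emb-⊗ [] D = taut₁ (λ d → ⊤ᵇ ⇔ ⊤ᵇ ⩔ d)
emb-⊗ (κ ∷ C) D = ↔-trans (emb-++ (map (κ ∨ᶜ_) D) (C ⊗ D))
  (↔-trans (∧-cong (emb-map κ D) (emb-⊗ C D))
           (taut₃ (λ k c d → (k ⩔ d) ⩓ (c ⩔ d) ⇔ (k ⩓ c) ⩔ d)))

emb-neg : ∀ C → GL (emb (neg C) ↔ₘ ¬ₘ (emb C))
emb-neg [] = tautology ((∼ ⊤ᵇ ⩔ ⊥ᵇ) ⩓ ⊤ᵇ ⇔ ∼ ⊤ᵇ) _ []
emb-neg (κ ∷ C) = ↔-trans (emb-⊗ (negᶜ κ) (neg C))
  (taut₄ (λ a b c n → (n ⇔ ∼ c) ⇒
     ((⊤ᵇ ⇒ a) ⩓ (b ⇒ ⊥ᵇ) ⩓ ⊤ᵇ ⩔ n ⇔ ∼ ((a ⇒ b) ⩓ c))) · emb-neg C)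

emb-lit : ∀ a → GL (emb (lit a) ↔ₘ T a)
emb-lit a = taut₁ (λ a → (⊤ᵇ ⇒ a) ⩓ ⊤ᵇ ⇔ a)

□⁺-∧ : ∀ {a b} → GL (□⁺ a ∧ₘ □⁺ b ↔ₘ □⁺ (a ∧ₘ b))
□⁺-∧ = taut₅ (λ a b a' b' c → (a' ⇒ b' ⇒ c) ⇒ (c ⇒ a') ⇒ (c ⇒ b') ⇒
                ((a' ⩓ a) ⩓ (b' ⩓ b) ⇔ c ⩓ a ⩓ b))
  · □-∧ · □-mono (taut₂ (λ a b → a ⩓ b ⇒ a)) · □-mono (taut₂ (λ a b → a ⩓ b ⇒ b))

-- `T (a → b)` is by definition `□⁺` of `embᶜ (a , b)`, and `□⁺` commutes with conjunction.
T-int : ∀ C → GL (T (int C) ↔ₘ □⁺ (emb C))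
T-int [] = taut₁ (λ a → a ⇒ (⊤ᵇ ⇔ a)) · □⁺-intro (tautology ⊤ᵇ _ [])
T-int (κ ∷ C) = ↔-trans (∧-cong ↔-refl (T-int C)) □⁺-∧

□-T-int : ∀ C → GL (□ (T (int C)) ↔ₘ □ (emb C))
□-T-int C = ↔-trans (□-cong (T-int C)) (↔-intro (□-mono □⁺-elim)
  (taut₃ (λ a b c → (a ⇒ b) ⇒ (b ⇒ a ⇒ c) ⇒ a ⇒ c) · □-4 · □-∧))

emb-cnf : ∀ c s → (∀ n → GL (emb (c n) ↔ₘ s n)) →
          ∀ ψ → GL (emb (cnf c ψ) ↔ₘ substM s ψ)
emb-cnf c s h (pₘ n) = h n
emb-cnf c s h ⊥ₘ = emb-lit ⊥ᵢ
emb-cnf c s h ⊤ₘ = ↔-refl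
emb-cnf c s h (φ ∧ₘ ψ) =
  ↔-trans (emb-++ (cnf c φ) (cnf c ψ)) (∧-cong (emb-cnf c s h φ) (emb-cnf c s h ψ))
emb-cnf c s h (φ ∨ₘ ψ) =
  ↔-trans (emb-⊗ (cnf c φ) (cnf c ψ)) (∨-cong (emb-cnf c s h φ) (emb-cnf c s h ψ))
emb-cnf c s h (¬ₘ φ) = ↔-trans (emb-neg (cnf c φ)) (¬-cong (emb-cnf c s h φ))
emb-cnf c s h (□ φ) =
  ↔-trans (emb-lit (⊠ (int (cnf c φ))))
          (↔-trans (□-T-int (cnf c φ)) (□-cong (emb-cnf c s h φ)))

-- The literal of `pᵢ n` embeds as `T (pᵢ n)`, that is `□⁺ (pₘ n)`. A Boolean combination of such
-- open variables thus becomes a translation once `□⁺` is applied.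
T-int-cnf : ∀ ψ → GL (T (int (cnf (lit ∘ pᵢ) ψ)) ↔ₘ □⁺ (substM (□⁺ ∘ pₘ) ψ))
T-int-cnf ψ = ↔-trans (T-int (cnf (lit ∘ pᵢ) ψ))
  (□⁺-cong (emb-cnf (lit ∘ pᵢ) (□⁺ ∘ pₘ) (λ n → emb-lit (pᵢ n)) ψ))

-- Boolean combinations of open formulas

substM-∘ : ∀ t s ψ → substM t (substM s ψ) ≡ substM (substM t ∘ s) ψ
substM-∘ t s (pₘ n) = refl
substM-∘ t s ⊥ₘ = refl
substM-∘ t s ⊤ₘ = refl
substM-∘ t s (φ ∧ₘ ψ) = cong₂ _∧ₘ_ (substM-∘ t s φ) (substM-∘ t s ψ)
substM-∘ t s (φ ∨ₘ ψ) = cong₂ _∨ₘ_ (substM-∘ t s φ) (substM-∘ t s ψ)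
substM-∘ t s (¬ₘ φ) = cong ¬ₘ (substM-∘ t s φ)
substM-∘ t s (□ φ) = cong □ (substM-∘ t s φ)

-- Assignments and finite search

Assignment : {A : Set} → List A → Set
Assignment = All (λ _ → Bool)

-- Values belong to positions and are found by a membership proof, which avoids deciding equality of
-- formulas; a repeated formula may carry different values.
get : ∀ {A : Set} {xs : List A} → Assignment xs → ∀ {x} → x ∈ xs → Bool
get (b ∷ v) (here _) = b
get (b ∷ v) (there m) = get v m

∈-search : ∀ {A : Set} (xs : List A) {P Q : ∀ {x} → x ∈ xs → Set} →
           (∀ {x} (m : x ∈ xs) → P m ⊎ Q m) →
           (∀ {x} (m : x ∈ xs) → P m) ⊎ (Σ A λ x → Σ (x ∈ xs) Q)
∈-search [] h = inj₁ λ ()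
∈-search (x ∷ xs) {P} {Q} h
  with h (here refl) | ∈-search xs {P ∘ there} {Q ∘ there} (h ∘ there)
... | inj₂ n | _ = inj₂ (x , here refl , n)
... | inj₁ _ | inj₂ (y , m , n) = inj₂ (y , there m , n)
... | inj₁ y | inj₁ ys = inj₁ λ { (here refl) → y ; (there m) → ys m }

-- Constructively, whether a suitable assignment exists is settled by running through all of them.
assignment-search : ∀ {A : Set} (xs : List A) {P Q : Assignment xs → Set} →
                    (∀ v → P v ⊎ Q v) → Σ (Assignment xs) P ⊎ (∀ v → Q v)
assignment-search [] h with h []
... | inj₁ y = inj₁ ([] , y)
... | inj₂ n = inj₂ λ { [] → n }
assignment-search (x ∷ xs) h
  with assignment-search xs (h ∘ (true ∷_)) | assignment-search xs (h ∘ (false ∷_))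
... | inj₁ (v , y) | _ = inj₁ (true ∷ v , y)
... | inj₂ _ | inj₁ (v , y) = inj₁ (false ∷ v , y)
... | inj₂ n | inj₂ n' = inj₂ λ { (true ∷ v) → n v ; (false ∷ v) → n' v }

-- Signed formulas, critical points and cells

sgn : Bool → MFm → MFm
sgn true φ = φ
sgn false φ = ¬ₘ φ

sgn-⊥ : ∀ {G} → GL (G →ₘ ¬ₘ ⊥ₘ)
sgn-⊥ = taut₁ (λ g → g ⇒ ∼ ⊥ᵇ)

sgn-⊤ : ∀ {G} → GL (G →ₘ ⊤ₘ)
sgn-⊤ = taut₁ (λ g → g ⇒ ⊤ᵇ)

sgn-∧ : ∀ {G φ ψ} b b' → GL (G →ₘ sgn b φ) → GL (G →ₘ sgn b' ψ) →
        GL (G →ₘ sgn (b B.∧ b') (φ ∧ₘ ψ))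
sgn-∧ true true d e = taut₃ (λ g a b → (g ⇒ a) ⇒ (g ⇒ b) ⇒ g ⇒ a ⩓ b) · d · e
sgn-∧ true false d e = taut₃ (λ g a b → (g ⇒ ∼ b) ⇒ g ⇒ ∼ (a ⩓ b)) · e
sgn-∧ false b' d e = taut₃ (λ g a b → (g ⇒ ∼ a) ⇒ g ⇒ ∼ (a ⩓ b)) · d

sgn-∨ : ∀ {G φ ψ} b b' → GL (G →ₘ sgn b φ) → GL (G →ₘ sgn b' ψ) →
        GL (G →ₘ sgn (b B.∨ b') (φ ∨ₘ ψ))
sgn-∨ false false d e = taut₃ (λ g a b → (g ⇒ ∼ a) ⇒ (g ⇒ ∼ b) ⇒ g ⇒ ∼ (a ⩔ b)) · d · e
sgn-∨ false true d e = taut₃ (λ g a b → (g ⇒ b) ⇒ g ⇒ a ⩔ b) · e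
sgn-∨ true b' d e = taut₃ (λ g a b → (g ⇒ a) ⇒ g ⇒ a ⩔ b) · d

sgn-¬ : ∀ {G φ} b → GL (G →ₘ sgn b φ) → GL (G →ₘ sgn (B.not b) (¬ₘ φ))
sgn-¬ true d = taut₂ (λ g a → (g ⇒ a) ⇒ g ⇒ ∼ (∼ a)) · d
sgn-¬ false d = d

sgn-cong : ∀ {G H φ ψ} b → GL (G →ₘ (φ ↔ₘ ψ)) → GL (H →ₘ sgn b ψ) →
           GL (G ∧ₘ H →ₘ sgn b φ)
sgn-cong true d e = taut₄ (λ g h a b → (g ⇒ (a ⇔ b)) ⇒ (h ⇒ b) ⇒ g ⩓ h ⇒ a) · d · e
sgn-cong false d e = taut₄ (λ g h a b → (g ⇒ (a ⇔ b)) ⇒ (h ⇒ ∼ b) ⇒ g ⩓ h ⇒ ∼ a) · d · e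

-- The points refuting χ for the last time: no two of them are comparable.
crit : MFm → MFm
crit χ = □ χ ∧ₘ ¬ₘ χ

-- Off the critical points `□ χ` entails `χ`, hence `□⁺ χ` in the true case.
cell : Bool → MFm → MFm
cell true χ = □⁺ χ
cell false χ = ¬ₘ (□ χ)

-- The points that are critical for no member of χs, sorted by which of the
-- formulas □ χ they satisfy.
cells : ∀ χs → Assignment χs → MFm
cells [] [] = ⊤ₘ
cells (χ ∷ χs) (b ∷ X) = cell b χ ∧ₘ cells χs X

cells-lookup : ∀ {χs χ} X (m : χ ∈ χs) → GL (cells χs X →ₘ cell (get X m) χ)
cells-lookup (b ∷ X) (here refl) = taut₂ (λ a b → a ⩓ b ⇒ a)
cells-lookup (b ∷ X) (there m) = taut₂ (λ a b → a ⩓ b ⇒ b) ⨾ cells-lookup X m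

cell-sgn : ∀ b {χ} → GL (cell b χ →ₘ sgn b (□ χ))
cell-sgn true = taut₂ (λ a b → a ⩓ b ⇒ a)
cell-sgn false = taut₁ (λ a → a ⇒ a)

cells-split : ∀ χs {θ} → (∀ {χ} → χ ∈ χs → GL (crit χ →ₘ θ)) →
              (∀ X → GL (cells χs X →ₘ θ)) → GL θ
cells-split [] g h = taut₁ (λ a → (⊤ᵇ ⇒ a) ⇒ a) · h []
cells-split (χ ∷ χs) g h = cells-split χs (g ∘ there) λ X →
  taut₄ (λ a b s t → (a ⩓ ∼ b ⇒ t) ⇒ ((a ⩓ b) ⩓ s ⇒ t) ⇒ (∼ a ⩓ s ⇒ t) ⇒ s ⇒ t)
  · g (here refl) · h (true ∷ X) · h (false ∷ X)

lits : ∀ vs → Assignment vs → MFm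
lits [] [] = ⊤ₘ
lits (n ∷ vs) (b ∷ v) = sgn b (pₘ n) ∧ₘ lits vs v

lits-lookup : ∀ {vs n} v (m : n ∈ vs) → GL (lits vs v →ₘ sgn (get v m) (pₘ n))
lits-lookup (b ∷ v) (here refl) = taut₂ (λ a b → a ⩓ b ⇒ a)
lits-lookup (b ∷ v) (there m) = taut₂ (λ a b → a ⩓ b ⇒ b) ⨾ lits-lookup v m

lits-split : ∀ vs {θ} → (∀ v → GL (lits vs v →ₘ θ)) → GL θ
lits-split [] h = taut₁ (λ a → (⊤ᵇ ⇒ a) ⇒ a) · h []
lits-split (n ∷ vs) h = lits-split vs λ v →
  taut₃ (λ a s t → (a ⩓ s ⇒ t) ⇒ (∼ a ⩓ s ⇒ t) ⇒ s ⇒ t) · h (true ∷ v) · h (false ∷ v)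

valuation : ∀ {vs} → Assignment vs → ℕ → Bool
valuation {vs} v n with n ∈? vs
... | yes m = get v m
... | no _ = false

lits-valuation : ∀ {vs n} v → n ∈ vs → GL (lits vs v →ₘ sgn (valuation v n) (pₘ n))
lits-valuation {vs} {n} v m with n ∈? vs
... | yes m' = lits-lookup v m'
... | no ∉vs = ⊥-elim (∉vs m)

-- The redefined variables as combinations of open formulas

double : ℕ → ℕ
double zero = zero
double (suc n) = suc (suc (double n))

-- Interleaving: `f` occupies the even and `g` the odd positions, so that the open formulas of all
-- members of `χs` fit into one sequence.
merge : {A : Set} → (ℕ → A) → (ℕ → A) → ℕ → A
merge f g zero = f zero
merge f g (suc n) = merge g (f ∘ suc) n

merge-even : ∀ {A : Set} (f g : ℕ → A) n → merge f g (double n) ≡ f n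
merge-even f g zero = refl
merge-even f g (suc n) = merge-even (f ∘ suc) (g ∘ suc) n

merge-odd : ∀ {A : Set} (f g : ℕ → A) n → merge f g (suc (double n)) ≡ g n
merge-odd f g = merge-even g (f ∘ suc)

-- Slots 0 and 1 locate a point relative to `χ`; slot `2 + j` records `pₘ j` at the critical points.
-- Under `merge` slot i gets index 2i, which is why `tree` consults `a 0`, `a 2` and
-- `a (double (suc (suc j)))`.
slots : MFm → ℕ → MFm
slots χ 0 = □ χ
slots χ 1 = χ
slots χ (suc (suc j)) = crit χ →ₘ pₘ j

opens : List MFm → ℕ → MFm
opens [] n = ⊤ₘ
opens (χ ∷ χs) = merge (slots χ) (opens χs)

leaf : Bool → MFm
leaf true = ⊤ₘ
leaf false = ⊥ₘ

-- When a enumerates the formulas □⁺ (opens χs n), this is pₘ j at critical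
-- points and the constant k X on cells χs X. The disjunct for critical points
-- needs only open formulas: as these points are incomparable, pₘ j agrees there
-- with □⁺ (crit χ → pₘ j).
tree : ∀ (χs : List MFm) (a : ℕ → MFm) (j : ℕ) (k : Assignment χs → Bool) → MFm
tree [] a j k = leaf (k [])
tree (χ ∷ χs) a j k =
  (¬ₘ (a 0) ∧ₘ tree χs (a ∘ suc ∘ double) j (k ∘ (false ∷_))) ∨ₘ
  (a 2 ∧ₘ tree χs (a ∘ suc ∘ double) j (k ∘ (true ∷_))) ∨ₘ
  ((a 0 ∧ₘ ¬ₘ (a 2)) ∧ₘ a (double (suc (suc j))))

subst-leaf : ∀ t b → substM t (leaf b) ≡ leaf b
subst-leaf t true = refl
subst-leaf t false = refl

subst-tree : ∀ t χs a j k → substM t (tree χs a j k) ≡ tree χs (substM t ∘ a) j k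
subst-tree t [] a j k = subst-leaf t (k [])
subst-tree t (χ ∷ χs) a j k
  rewrite subst-tree t χs (a ∘ suc ∘ double) j (k ∘ (false ∷_))
        | subst-tree t χs (a ∘ suc ∘ double) j (k ∘ (true ∷_)) = refl

-- Strictly above a point with `□ χ` the formula `crit χ → φ` holds vacuously, so its box is free
-- there.
crit-□⁺ : ∀ {χ φ} → GL ((□ χ ∧ₘ ¬ₘ (□⁺ χ)) ∧ₘ □⁺ (crit χ →ₘ φ) ↔ₘ crit χ ∧ₘ φ)
crit-□⁺ = taut₄ (λ a b d p → (a ⇒ d) ⇒
    ((a ⩓ ∼ (a ⩓ b)) ⩓ (d ⩓ (a ⩓ ∼ b ⇒ p)) ⇔ (a ⩓ ∼ b) ⩓ p))
  · □-mono (taut₃ (λ b a p → b ⇒ a ⩓ ∼ b ⇒ p))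

tree-node : ∀ χ χs {a : ℕ → MFm} → (∀ n → a n ≡ □⁺ (opens (χ ∷ χs) n)) → ∀ j k →
  GL (tree (χ ∷ χs) a j k ↔ₘ
      (¬ₘ (□ χ) ∧ₘ tree χs (a ∘ suc ∘ double) j (k ∘ (false ∷_))) ∨ₘ
      (□⁺ χ ∧ₘ tree χs (a ∘ suc ∘ double) j (k ∘ (true ∷_))) ∨ₘ
      (crit χ ∧ₘ pₘ j))
tree-node χ χs e j k
  rewrite e 0 | e 2 | e (double (suc (suc j)))
        | merge-even (slots χ) (opens χs) (suc (suc j)) =
  ∨-cong (∧-cong (¬-cong □χ) ↔-refl)
         (∨-cong ↔-refl (↔-trans (∧-cong (∧-cong □χ ↔-refl) ↔-refl) crit-□⁺))
  where
  □χ : GL (□⁺ (□ χ) ↔ₘ □ χ)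
  □χ = taut₂ (λ a b → (a ⇔ b) ⇒ (b ⇔ a)) · open-fix □-4

tail-opens : ∀ χ χs {a : ℕ → MFm} → (∀ n → a n ≡ □⁺ (opens (χ ∷ χs) n)) →
             ∀ n → a (suc (double n)) ≡ □⁺ (opens χs n)
tail-opens χ χs e n =
  trans (e (suc (double n))) (cong □⁺ (merge-odd (slots χ) (opens χs) n))

-- At a point critical for a later member, all three branches of the head agree with `pₘ j`: two by
-- induction, the third because it is `pₘ j` itself.
tree-crit : ∀ {χs} {a : ℕ → MFm} → (∀ n → a n ≡ □⁺ (opens χs n)) → ∀ {χ} → χ ∈ χs → ∀ j k →
            GL (crit χ →ₘ (tree χs a j k ↔ₘ pₘ j))
tree-crit {χ ∷ χs} e (here refl) j k =
  taut₆ (λ a b f t p x → (x ⇔ (∼ a ⩓ f) ⩔ ((a ⩓ b) ⩓ t) ⩔ ((a ⩓ ∼ b) ⩓ p)) ⇒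
           a ⩓ ∼ b ⇒ (x ⇔ p))
  · tree-node χ χs e j k
tree-crit {χ ∷ χs} e (there m) j k =
  taut₄ (λ c n x p → (x ⇔ n) ⇒ (c ⇒ (n ⇔ p)) ⇒ c ⇒ (x ⇔ p))
  · tree-node χ χs e j k ·
  (taut₆ (λ c a b f t p → (c ⇒ (f ⇔ p)) ⇒ (c ⇒ (t ⇔ p)) ⇒
            c ⇒ ((∼ a ⩓ f) ⩔ ((a ⩓ b) ⩓ t) ⩔ ((a ⩓ ∼ b) ⩓ p) ⇔ p))
   · tree-crit (tail-opens χ χs e) m j (k ∘ (false ∷_))
   · tree-crit (tail-opens χ χs e) m j (k ∘ (true ∷_)))

tree-cells : ∀ {χs} {a : ℕ → MFm} → (∀ n → a n ≡ □⁺ (opens χs n)) →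
             ∀ j (k : Assignment χs → Bool) X →
             GL (cells χs X →ₘ sgn (k X) (tree χs a j k))
tree-cells {[]} e j k [] with k []
... | true = sgn-⊤
... | false = sgn-⊥
tree-cells {χ ∷ χs} e j k (true ∷ X) = sgn-cong (k (true ∷ X))
  (taut₆ (λ a b f t c x → (x ⇔ (∼ a ⩓ f) ⩔ ((a ⩓ b) ⩓ t) ⩔ ((a ⩓ ∼ b) ⩓ c)) ⇒
            a ⩓ b ⇒ (x ⇔ t)) · tree-node χ χs e j k)
  (tree-cells (tail-opens χ χs e) j (k ∘ (true ∷_)) X)
tree-cells {χ ∷ χs} e j k (false ∷ X) = sgn-cong (k (false ∷ X))
  (taut₆ (λ a b f t c x → (x ⇔ (∼ a ⩓ f) ⩔ ((a ⩓ b) ⩓ t) ⩔ ((a ⩓ ∼ b) ⩓ c)) ⇒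
            ∼ a ⇒ (x ⇔ f)) · tree-node χ χs e j k)
  (tree-cells (tail-opens χ χs e) j (k ∘ (false ∷_)) X)

-- Subformulas

subs : MFm → List MFm
subs (pₘ n) = pₘ n ∷ []
subs ⊥ₘ = ⊥ₘ ∷ []
subs ⊤ₘ = ⊤ₘ ∷ []
subs (φ ∧ₘ ψ) = (φ ∧ₘ ψ) ∷ subs φ ++ subs ψ
subs (φ ∨ₘ ψ) = (φ ∨ₘ ψ) ∷ subs φ ++ subs ψ
subs (¬ₘ φ) = ¬ₘ φ ∷ subs φ
subs (□ φ) = □ φ ∷ subs φ

subs-refl : ∀ φ → φ ∈ subs φ
subs-refl (pₘ n) = here refl
subs-refl ⊥ₘ = here refl
subs-refl ⊤ₘ = here refl
subs-refl (φ ∧ₘ ψ) = here refl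
subs-refl (φ ∨ₘ ψ) = here refl
subs-refl (¬ₘ φ) = here refl
subs-refl (□ φ) = here refl

subs-trans : ∀ {χ} φ → χ ∈ subs φ → subs χ ⊆ subs φ
subs-trans (pₘ n) (here refl) = id
subs-trans ⊥ₘ (here refl) = id
subs-trans ⊤ₘ (here refl) = id
subs-trans (φ ∧ₘ ψ) (here refl) = id
subs-trans (φ ∧ₘ ψ) (there m) with ∈-++⁻ (subs φ) m
... | inj₁ m' = there ∘ ∈-++⁺ˡ ∘ subs-trans φ m'
... | inj₂ m' = there ∘ ∈-++⁺ʳ (subs φ) ∘ subs-trans ψ m'
subs-trans (φ ∨ₘ ψ) (here refl) = id
subs-trans (φ ∨ₘ ψ) (there m) with ∈-++⁻ (subs φ) m
... | inj₁ m' = there ∘ ∈-++⁺ˡ ∘ subs-trans φ m'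
... | inj₂ m' = there ∘ ∈-++⁺ʳ (subs φ) ∘ subs-trans ψ m'
subs-trans (¬ₘ φ) (here refl) = id
subs-trans (¬ₘ φ) (there m) = there ∘ subs-trans φ m
subs-trans (□ φ) (here refl) = id
subs-trans (□ φ) (there m) = there ∘ subs-trans φ m

index : MFm → List ℕ
index (pₘ n) = n ∷ []
index _ = []

implies? : ∀ b b' → (b ≡ true → b' ≡ true) ⊎ (b ≡ true × b' ≡ false)
implies? b true = inj₁ λ _ → refl
implies? true false = inj₂ (refl , refl)
implies? false false = inj₁ λ ()

witness-or : {A B : Set} {P : A → Set} → A → Σ A P ⊎ B → A
witness-or a = [ proj₁ , (λ _ → a) ]′

witness-or-spec : {A B : Set} {P : A → Set} {a : A} (z : Σ A P ⊎ B) → P (witness-or a z) ⊎ B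
witness-or-spec (inj₁ (_ , h)) = inj₁ h
witness-or-spec (inj₂ b) = inj₂ b

cell-implies : ∀ {G χ φ} b b' → (b ≡ true → b' ≡ true) →
               GL (G →ₘ cell b χ) → GL (G →ₘ sgn b' φ) → GL (G →ₘ □⁺ χ →ₘ φ)
cell-implies false b' h d e = taut₄ (λ g a b x → (g ⇒ ∼ a) ⇒ g ⇒ a ⩓ b ⇒ x) · d
cell-implies true b' h d e rewrite h refl = taut₃ (λ g b x → (g ⇒ x) ⇒ g ⇒ b ⇒ x) · e

-- Recursive in the formula, so that at each `□ φ` the position of `φ` in `χs` is at hand.
Covered : List ℕ → List MFm → MFm → Set
Covered vs χs (pₘ n) = n ∈ vs
Covered vs χs ⊥ₘ = ⊤
Covered vs χs ⊤ₘ = ⊤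
Covered vs χs (φ ∧ₘ ψ) = Covered vs χs φ × Covered vs χs ψ
Covered vs χs (φ ∨ₘ ψ) = Covered vs χs φ × Covered vs χs ψ
Covered vs χs (¬ₘ φ) = Covered vs χs φ
Covered vs χs (□ φ) = φ ∈ χs × Covered vs χs φ

-- Redefining the variables off the critical points

module Reduction (vs : List ℕ) (χs : List MFm)
                 (covered : ∀ {χ} → χ ∈ χs → Covered vs χs χ) where

  -- On a cell the boxed formulas have fixed truth values, so formulas are evaluated propositionally
  -- with the boxes as further atoms.
  eval : (ℕ → Bool) → Assignment χs → ∀ ψ → Covered vs χs ψ → Bool
  eval V X (pₘ n) h = V n
  eval V X ⊥ₘ h = false
  eval V X ⊤ₘ h = true
  eval V X (φ ∧ₘ ψ) (h , h') = eval V X φ h B.∧ eval V X ψ h'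
  eval V X (φ ∨ₘ ψ) (h , h') = eval V X φ h B.∨ eval V X ψ h'
  eval V X (¬ₘ φ) h = B.not (eval V X φ h)
  eval V X (□ φ) (m , _) = get X m

  eval-sound : ∀ v X ψ h →
    GL (cells χs X ∧ₘ lits vs v →ₘ sgn (eval (valuation v) X ψ h) ψ)
  eval-sound v X (pₘ n) m = taut₂ (λ a b → a ⩓ b ⇒ b) ⨾ lits-valuation v m
  eval-sound v X ⊥ₘ h = sgn-⊥
  eval-sound v X ⊤ₘ h = sgn-⊤
  eval-sound v X (φ ∧ₘ ψ) (h , h') =
    sgn-∧ _ (eval (valuation v) X ψ h') (eval-sound v X φ h) (eval-sound v X ψ h')
  eval-sound v X (φ ∨ₘ ψ) (h , h') =
    sgn-∨ _ (eval (valuation v) X ψ h') (eval-sound v X φ h) (eval-sound v X ψ h')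
  eval-sound v X (¬ₘ φ) h = sgn-¬ _ (eval-sound v X φ h)
  eval-sound v X (□ φ) (m , _) =
    taut₂ (λ a b → a ⩓ b ⇒ a) ⨾ cells-lookup X m ⨾ cell-sgn (get X m)

  Consistent : Assignment χs → Assignment vs → Set
  Consistent X v = ∀ {χ} (m : χ ∈ χs) → get X m ≡ true →
                   eval (valuation v) X χ (covered m) ≡ true

  -- A cell with value true for `χ` satisfies `□⁺ χ`, in particular `χ`; literals under which `χ`
  -- evaluates to false exclude that cell.
  refute : ∀ X v → (Σ MFm λ χ → Σ (χ ∈ χs) λ m →
             get X m ≡ true × eval (valuation v) X χ (covered m) ≡ false) →
           GL (lits vs v →ₘ ¬ₘ (cells χs X))
  refute X v (χ , m , e , f) =
    taut₄ (λ c l a b → (c ⩓ l ⇒ ∼ b) ⇒ (c ⇒ a ⩓ b) ⇒ l ⇒ ∼ c)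
    · subst (λ b → GL (_ →ₘ sgn b χ)) f (eval-sound v X χ (covered m))
    · subst (λ b → GL (_ →ₘ cell b χ)) e (cells-lookup X m)

  -- If every valuation fails, each choice of literals refutes the cell, hence GL does.
  consistent? : ∀ X → Σ (Assignment vs) (Consistent X) ⊎ GL (¬ₘ (cells χs X))
  consistent? X = Sum.map₂
    (λ fail → lits-split vs λ v → refute X v (fail v))
    (assignment-search vs λ v → ∈-search χs λ {χ} m →
      implies? (get X m) (eval (valuation v) X χ (covered m)))

  pick : Assignment χs → Assignment vs
  -- The all-false assignment stands in on cells that GL refutes.
  pick X = witness-or (All.universal (λ _ → false) vs) (consistent? X)

  pick-consistent : ∀ X → Consistent X (pick X) ⊎ GL (¬ₘ (cells χs X))
  pick-consistent X = witness-or-spec (consistent? X)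

  value : Assignment χs → ∀ ψ → Covered vs χs ψ → Bool
  value X = eval (valuation (pick X)) X

  code : ℕ → MFm
  code j = tree χs pₘ j (λ X → valuation (pick X) j)

  s : ℕ → MFm
  s = substM (□⁺ ∘ opens χs) ∘ code

  s-tree : ∀ j → s j ≡ tree χs (□⁺ ∘ opens χs) j (λ X → valuation (pick X) j)
  s-tree j = subst-tree (□⁺ ∘ opens χs) χs pₘ j _

  -- Only at critical points does `ψ` keep its truth value; on a cell the instance takes the
  -- computed constant, which may differ from that of `ψ`.
  Preserved : MFm → Set
  Preserved ψ =
    (∀ {χ} → χ ∈ χs → GL (crit χ →ₘ (substM s ψ ↔ₘ ψ))) ×
    (∀ X h → GL (cells χs X →ₘ sgn (value X ψ h) (substM s ψ)))

  -- At critical points `χ` is unchanged. On a cell where `□⁺ χ` holds, consistency of the chosen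
  -- valuation makes the constant true, unless the cell is refuted.
  □⁺→s : ∀ {χ} → χ ∈ χs → Preserved χ → GL (□⁺ χ →ₘ substM s χ)
  □⁺→s {χ} m (f , g) = cells-split χs
    (λ m' → taut₄ (λ c a b x → (c ⇒ (x ⇔ b)) ⇒ c ⇒ a ⩓ b ⇒ x) · f m')
    λ X → [ (λ c → cell-implies (get X m) _ (c m) (cells-lookup X m) (g X (covered m)))
          , (λ d → taut₂ (λ a b → ∼ a ⇒ a ⇒ b) · d) ]′ (pick-consistent X)

  -- Left to right: given the instance of `χ`, a failure of `χ` under `□ χ` would be critical, where
  -- the two agree; so `□ χ → χ`, and Löb's axiom applies under the box. Right to left: transitivity
  -- gives `□ (□⁺ χ)`, and `□⁺→s` applies inside.
  □s↔□ : ∀ {χ} → χ ∈ χs → Preserved χ → GL (□ (substM s χ) ↔ₘ □ χ)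
  □s↔□ {χ} m P = ↔-intro
    (□-mono (taut₃ (λ a b x → (a ⩓ ∼ b ⇒ (x ⇔ b)) ⇒ x ⇒ a ⇒ b) · proj₁ P m) ⨾ □-löb)
    ((taut₃ (λ a b c → (a ⇒ b) ⇒ (b ⇒ a ⇒ c) ⇒ a ⇒ c) · □-4 · □-∧) ⨾ □-mono (□⁺→s m P))

  preserved : ∀ ψ → Covered vs χs ψ → Preserved ψ
  preserved (pₘ n) _ =
    (λ {χ} m → subst (λ φ → GL (crit χ →ₘ (φ ↔ₘ pₘ n))) (sym (s-tree n))
                     (tree-crit (λ _ → refl) m n _)) ,
    λ X _ → subst (λ φ → GL (cells χs X →ₘ sgn (valuation (pick X) n) φ)) (sym (s-tree n))
                  (tree-cells (λ _ → refl) n _ X)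
  preserved ⊥ₘ _ = (λ _ → taut₁ (λ a → a ⇒ (⊥ᵇ ⇔ ⊥ᵇ))) , λ _ _ → sgn-⊥
  preserved ⊤ₘ _ = (λ _ → taut₁ (λ a → a ⇒ (⊤ᵇ ⇔ ⊤ᵇ))) , λ _ _ → sgn-⊤
  preserved (φ ∧ₘ ψ) (h , h') with preserved φ h | preserved ψ h'
  ... | f , g | f' , g' =
    (λ m → taut₅ (λ c a b x y → (c ⇒ (a ⇔ x)) ⇒ (c ⇒ (b ⇔ y)) ⇒ c ⇒ (a ⩓ b ⇔ x ⩓ y))
           · f m · f' m) ,
    λ X (u , w) → sgn-∧ _ (value X ψ w) (g X u) (g' X w)
  preserved (φ ∨ₘ ψ) (h , h') with preserved φ h | preserved ψ h'
  ... | f , g | f' , g' =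
    (λ m → taut₅ (λ c a b x y → (c ⇒ (a ⇔ x)) ⇒ (c ⇒ (b ⇔ y)) ⇒ c ⇒ (a ⩔ b ⇔ x ⩔ y))
           · f m · f' m) ,
    λ X (u , w) → sgn-∨ _ (value X ψ w) (g X u) (g' X w)
  preserved (¬ₘ φ) h with preserved φ h
  ... | f , g =
    (λ m → taut₃ (λ c a x → (c ⇒ (a ⇔ x)) ⇒ c ⇒ (∼ a ⇔ ∼ x)) · f m) ,
    λ X u → sgn-¬ _ (g X u)
  preserved (□ φ) (m , h) =
    (λ _ → taut₂ (λ c a → a ⇒ c ⇒ a) · same) ,
    λ X (m' , _) → taut₁ (λ a → a ⇒ a ⩓ a) ⨾ sgn-cong (get X m')
      (taut₂ (λ c a → a ⇒ c ⇒ a) · same)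
      (cells-lookup X m' ⨾ cell-sgn (get X m'))
    where
    same : GL (□ (substM s φ) ↔ₘ □ φ)
    same = □s↔□ m (preserved φ h)

  -- The boxed half gives `□ χ`; if `χ` failed, the point would be critical, where the instance
  -- agrees with `χ`.
  □⁺s→ : ∀ {χ} → χ ∈ χs → Preserved χ → GL (□⁺ (substM s χ) →ₘ χ)
  □⁺s→ m P = taut₄ (λ a b x y → (y ⇔ a) ⇒ (a ⩓ ∼ b ⇒ (x ⇔ b)) ⇒ y ⩓ x ⇒ b)
    · □s↔□ m P · proj₁ P m

module _ (vs : List ℕ) (χs : List MFm) (⊆vs : ∀ {n} → pₘ n ∈ χs → n ∈ vs) where

  covered-subs : ∀ φ → subs φ ⊆ χs → Covered vs χs φ
  covered-subs (pₘ n) h = ⊆vs (h (here refl))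
  covered-subs ⊥ₘ h = tt
  covered-subs ⊤ₘ h = tt
  covered-subs (φ ∧ₘ ψ) h =
    covered-subs φ (h ∘ there ∘ ∈-++⁺ˡ) , covered-subs ψ (h ∘ there ∘ ∈-++⁺ʳ (subs φ))
  covered-subs (φ ∨ₘ ψ) h =
    covered-subs φ (h ∘ there ∘ ∈-++⁺ˡ) , covered-subs ψ (h ∘ there ∘ ∈-++⁺ʳ (subs φ))
  covered-subs (¬ₘ φ) h = covered-subs φ (h ∘ there)
  covered-subs (□ φ) h = h (there (subs-refl φ)) , covered-subs φ (h ∘ there)

-- The instance is given as code followed by pₘ n ↦ □⁺ (o n), since T-int-cnf
-- turns code ψ into a translation once its variables are read as open formulas.
interderivable-instance : ∀ Ψ → Σ (ℕ → MFm) λ code → Σ (ℕ → MFm) λ o →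
  ∀ {ψ} → ψ ∈ Ψ →
  GL (□⁺ ψ →ₘ substM (substM (□⁺ ∘ o) ∘ code) ψ) ×
  GL (□⁺ (substM (substM (□⁺ ∘ o) ∘ code) ψ) →ₘ ψ)
interderivable-instance Ψ = code , opens χs , λ m →
  □⁺→s (Ψ⊆χs m) (preserved _ (covered (Ψ⊆χs m))) ,
  □⁺s→ (Ψ⊆χs m) (preserved _ (covered (Ψ⊆χs m)))
  where
  χs = concatMap subs Ψ
  vs = concatMap index χs

  Ψ⊆χs : Ψ ⊆ χs
  Ψ⊆χs {ψ} m = ∈-concatMap⁺ subs (Any.map (λ { refl → subs-refl ψ }) m)

  covered : ∀ {χ} → χ ∈ χs → Covered vs χs χ
  covered {χ} m = covered-subs vs χs
    (λ m' → ∈-concatMap⁺ index (Any.map (λ { refl → here refl }) m'))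
    χ (λ m' → ∈-concatMap⁺ subs
                (Any.map (λ {ψ} h → subs-trans ψ h m') (∈-concatMap⁻ subs {xs = Ψ} m)))

  open Reduction vs χs covered

-- Rules and rule systems

-- A common form of `substR` and `TR`, which lets their composites be fused.
mapR : {F G : Set} → (F → G) → Rule F → Rule G
mapR f (Γ / Δ) = map f Γ / map f Δ

mapR-∘ : {F G H : Set} (g : G → H) (f : F → G) (ru : Rule F) →
         mapR g (mapR f ru) ≡ mapR (g ∘ f) ru
mapR-∘ g f (Γ / Δ) = cong₂ _/_ (sym (map-∘ Γ)) (sym (map-∘ Δ))

mapR-cong : {F G : Set} {f g : F → G} → (∀ φ → f φ ≡ g φ) → ∀ ru → mapR f ru ≡ mapR g ru
mapR-cong e (Γ / Δ) = cong₂ _/_ (map-cong e Γ) (map-cong e Δ)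

mapR-id : {F : Set} {f : F → F} → (∀ φ → f φ ≡ φ) → ∀ ru → mapR f ru ≡ ru
mapR-id e (Γ / Δ) =
  cong₂ _/_ (trans (map-cong e Γ) (map-id Γ)) (trans (map-cong e Δ) (map-id Δ))

substR-mapR : ∀ {F} (sb : (ℕ → F) → F → F) s ru → substR sb s ru ≡ mapR (sb s) ru
substR-mapR sb s (Γ / Δ) = refl

TR-mapR : ∀ ru → TR ru ≡ mapR T ru
TR-mapR (Γ / Δ) = refl

module RuleSystem {F : Set} {sb : (ℕ → F) → F → F} {S : Pred (Rule F) 0ℓ}
                  (rs : IsRuleSystem sb S) where
  open IsRuleSystem rs

  discharge-premises : ∀ Γ {Γ' Δ} → S ((Γ ++ Γ') / Δ) →
    (∀ {γ} → γ ∈ Γ → S (Γ' / (γ ∷ []))) → S (Γ' / Δ)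
  discharge-premises [] d h = d
  discharge-premises (γ ∷ Γ) {Γ'} {Δ} d h = discharge-premises Γ
    (rs-cut _ _ γ (rs-weak _ _ _ _ (∈-++⁺ʳ Γ) (λ { (here e) → here e }) (h (here refl))) d)
    (h ∘ there)

  discharge-conclusions : ∀ Δ {Γ Δ'} → S (Γ / (Δ ++ Δ')) →
    (∀ {δ} → δ ∈ Δ → S ((δ ∷ []) / Δ')) → S (Γ / Δ')
  discharge-conclusions [] d h = d
  discharge-conclusions (δ ∷ Δ) {Γ} {Δ'} d h = discharge-conclusions Δ
    (rs-cut _ _ δ d (rs-weak _ _ _ _ (λ { (here e) → here e }) (∈-++⁺ʳ Δ) (h (here refl))))
    (h ∘ there)

  replace : ∀ {Γ Δ Γ' Δ'} → S (Γ / Δ) → (∀ {γ} → γ ∈ Γ → S (Γ' / (γ ∷ []))) →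
            (∀ {δ} → δ ∈ Δ → S ((δ ∷ []) / Δ')) → S (Γ' / Δ')
  replace {Γ} {Δ} {Γ'} {Δ'} d g h = discharge-premises Γ
    (discharge-conclusions Δ (rs-weak _ _ _ _ ∈-++⁺ˡ ∈-++⁺ˡ d)
      (λ m → rs-weak _ _ _ _ (λ { (here e) → here e }) id (h m)))
    g

  -- Premises and conclusions are exchanged by cuts in opposite directions.
  replace-map : {A : Set} (f f' : A → F) → ∀ Γ Δ →
    (∀ {φ} → φ ∈ Γ → S ((f' φ ∷ []) / (f φ ∷ []))) →
    (∀ {φ} → φ ∈ Δ → S ((f φ ∷ []) / (f' φ ∷ []))) →
    S (map f Γ / map f Δ) → S (map f' Γ / map f' Δ)
  replace-map f f' Γ Δ g h d = replace d premise conclusion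
    where
    premise : ∀ {γ} → γ ∈ map f Γ → S (map f' Γ / (γ ∷ []))
    premise m with ∈-map⁻ f m
    ... | φ , m' , refl = rs-weak _ _ _ _ (λ { (here refl) → ∈-map⁺ f' m' }) id (g m')

    conclusion : ∀ {δ} → δ ∈ map f Δ → S ((δ ∷ []) / map f' Δ)
    conclusion m with ∈-map⁻ f m
    ... | φ , m' , refl = rs-weak _ _ _ _ id (λ { (here refl) → ∈-map⁺ f' m' }) (h m')

  replaceR : {A : Set} (f f' : A → F) →
    (∀ φ → S ((f' φ ∷ []) / (f φ ∷ []))) → (∀ φ → S ((f φ ∷ []) / (f' φ ∷ []))) →
    ∀ ru → S (mapR f ru) → S (mapR f' ru)
  replaceR f f' g h (Γ / Δ) = replace-map f f' Γ Δ (λ {φ} _ → g φ) (λ {φ} _ → h φ)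

  trans-rule : ∀ {φ ψ χ} → S ((φ ∷ []) / (ψ ∷ [])) → S ((ψ ∷ []) / (χ ∷ [])) →
               S ((φ ∷ []) / (χ ∷ []))
  trans-rule d e = replace e (λ { (here refl) → d }) λ { (here refl) → rs-refl _ }

  subst-mapR : ∀ s {A : Set} (f : A → F) ru → S (mapR f ru) → S (mapR (sb s ∘ f) ru)
  subst-mapR s f ru d =
    subst S (trans (substR-mapR sb s (mapR f ru)) (mapR-∘ (sb s) f ru)) (rs-subst s _ d)

RSClosure-isRS : ∀ {F} {sb : (ℕ → F) → F → F} {Bs} → IsRuleSystem sb (RSClosure sb Bs)
RSClosure-isRS = record
  { rs-subst = λ s _ → sub s
  ; rs-refl = refl
  ; rs-weak = λ _ _ _ _ → weak
  ; rs-cut = λ _ _ → cut }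

RSClosure-least : ∀ {F} {sb : (ℕ → F) → F → F} {Bs S} → IsRuleSystem sb S →
                  Bs ⊆ᵖ S → RSClosure sb Bs ⊆ᵖ S
RSClosure-least rs h (base b) = h b
RSClosure-least rs h (sub s d) = IsRuleSystem.rs-subst rs s _ (RSClosure-least rs h d)
RSClosure-least rs h (refl φ) = IsRuleSystem.rs-refl rs φ
RSClosure-least rs h (weak f g d) =
  IsRuleSystem.rs-weak rs _ _ _ _ f g (RSClosure-least rs h d)
RSClosure-least rs h (cut φ d e) =
  IsRuleSystem.rs-cut rs _ _ φ (RSClosure-least rs h d) (RSClosure-least rs h e)

MsiCl-mono : ∀ {A B} → A ⊆ᵖ B → MsiCl A ⊆ᵖ MsiCl B
MsiCl-mono h (base a) = base (h a)
MsiCl-mono h (ipck a) = ipck a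
MsiCl-mono h (sub s d) = sub s (MsiCl-mono h d)
MsiCl-mono h (mp d e) = mp (MsiCl-mono h d) (MsiCl-mono h e)
MsiCl-mono h (nec d) = nec (MsiCl-mono h d)

MsiCl-isMsiLogic : ∀ {A} → IsMsiLogic (MsiCl A)
MsiCl-isMsiLogic = record
  { ml-IPCK = MsiCl-mono λ ()
  ; ml-subst = λ s _ → sub s
  ; ml-mp = λ _ _ → mp
  ; ml-nec = λ _ → nec }

MsiCl-least : ∀ {A L} → IsMsiLogic L → A ⊆ᵖ L → MsiCl A ⊆ᵖ L
MsiCl-least i h (base a) = h a
MsiCl-least i h (ipck a) = IsMsiLogic.ml-IPCK i (ipck a)
MsiCl-least i h (sub s d) = IsMsiLogic.ml-subst i s _ (MsiCl-least i h d)
MsiCl-least i h (mp d e) = IsMsiLogic.ml-mp i _ _ (MsiCl-least i h d) (MsiCl-least i h e)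
MsiCl-least i h (nec d) = IsMsiLogic.ml-nec i _ (MsiCl-least i h d)

ModCl-mono : ∀ {A B} → A ⊆ᵖ B → ModCl A ⊆ᵖ ModCl B
ModCl-mono h (base a) = base (h a)
ModCl-mono h (taut a) = taut a
ModCl-mono h kax = kax
ModCl-mono h (sub s d) = sub s (ModCl-mono h d)
ModCl-mono h (mp d e) = mp (ModCl-mono h d) (ModCl-mono h e)
ModCl-mono h (nec d) = nec (ModCl-mono h d)

ModCl-isNormal : ∀ {A} → IsNormalModalLogic (ModCl A)
ModCl-isNormal = record
  { nl-K = ModCl-mono λ ()
  ; nl-subst = λ s _ → sub s
  ; nl-mp = λ _ _ → mp
  ; nl-nec = λ _ → nec }

ModCl-least : ∀ {A M} → IsNormalModalLogic M → A ⊆ᵖ M → ModCl A ⊆ᵖ M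
ModCl-least i h (base a) = h a
ModCl-least i h (taut a) = IsNormalModalLogic.nl-K i (taut a)
ModCl-least i h kax = IsNormalModalLogic.nl-K i kax
ModCl-least i h (sub s d) = IsNormalModalLogic.nl-subst i s _ (ModCl-least i h d)
ModCl-least i h (mp d e) =
  IsNormalModalLogic.nl-mp i _ _ (ModCl-least i h d) (ModCl-least i h e)
ModCl-least i h (nec d) = IsNormalModalLogic.nl-nec i _ (ModCl-least i h d)

MsiRS-isMsiRS : ∀ {A} → IsMsiRS (MsiRS A)
MsiRS-isMsiRS = record { is-rs = RSClosure-isRS ; msi = (λ d → base (inj₁ d)) }

ModRS-isModRS : ∀ {A} → IsModRS (ModRS A)
ModRS-isModRS = record { is-rs = RSClosure-isRS ; modal = (λ d → base (inj₁ d)) }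

MsiRS-least : ∀ {A S} → IsMsiRS S → A ⊆ᵖ S → MsiRS A ⊆ᵖ S
MsiRS-least i h = RSClosure-least (IsMsiRS.is-rs i) [ IsMsiRS.msi i , h ]

ModRS-least : ∀ {A S} → IsModRS S → A ⊆ᵖ S → ModRS A ⊆ᵖ S
ModRS-least i h = RSClosure-least (IsModRS.is-rs i) [ IsModRS.modal i , h ]

module KMRules {S} (NS : NExtKMR S) where
  open IsMsiRS (proj₁ NS) public
  open IsRuleSystem is-rs public
  open RuleSystem is-rs public

  theorem : ∀ {φ} → KM φ → S (ax/ φ)
  theorem d = proj₂ NS (base (inj₂ (_ , d , refl)))

  ≤-rule : ∀ {φ ψ} → φ ≤ ψ → S ((φ ∷ []) / (ψ ∷ []))
  ≤-rule d = replace (msi (mpR _ _))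
    (λ { (here refl) → rs-refl _
       ; (there (here refl)) → rs-weak _ _ _ _ (λ ()) id (theorem d) })
    λ { (here refl) → rs-refl _ }

module GLRules {M} (NM : NExtGLR M) where
  open IsModRS (proj₁ NM) public
  open IsRuleSystem is-rs public
  open RuleSystem is-rs public

  theorem : ∀ {φ} → GL φ → M (ax/ φ)
  theorem d = proj₂ NM (base (inj₂ (_ , d , refl)))

  →-rule : ∀ {φ ψ} → GL (φ →ₘ ψ) → M ((φ ∷ []) / (ψ ∷ []))
  →-rule d = replace (modal (mpR _ _))
    (λ { (here refl) → rs-refl _
       ; (there (here refl)) → rs-weak _ _ _ _ (λ ()) id (theorem d) })
    λ { (here refl) → rs-refl _ }

  -- Necessitation applies to premises of rules, so interderivability needs to be shown only up to
  -- `□⁺` on the left.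
  □⁺-rule : ∀ {φ ψ} → GL (□⁺ φ →ₘ ψ) → M ((φ ∷ []) / (ψ ∷ []))
  □⁺-rule {φ} d = replace (modal (mpR (□ φ) _))
    (λ { (here refl) → modal (necR φ)
       ; (there (here refl)) →
           →-rule (taut₃ (λ a b c → (a ⩓ b ⇒ c) ⇒ b ⇒ a ⇒ c) · d) })
    λ { (here refl) → rs-refl _ }

-- The maps on rule systems

σR-NExt : ∀ L → NExtKMR L → NExtGLR (σR L)
σR-NExt L _ = ModRS-isModRS , (λ d → base (inj₂ (inj₁ d)))

ρR-NExt : ∀ M → NExtGLR M → NExtKMR (ρR M)
ρR-NExt M NM = isMsi , MsiRS-least isMsi λ { (φ , d , refl) → theorem (T-sound d) }
  where
  open GLRules NM

  isMsi : IsMsiRS (ρR M)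
  isMsi .IsMsiRS.is-rs = record
    -- Translation commutes with substitution only up to GL, so the members of the rule are
    -- exchanged along `T-subst`.
    { rs-subst = λ s ru d → subst M
        (sym (trans (cong TR (substR-mapR substI s ru))
             (trans (TR-mapR _) (mapR-∘ T (substI s) ru))))
        (replaceR (substM (T ∘ s) ∘ T) (T ∘ substI s)
          (→-rule ∘ ↔-to ∘ T-subst s) (→-rule ∘ ↔-from ∘ T-subst s) ru
          (subst-mapR (T ∘ s) T ru (subst M (TR-mapR ru) d)))
    ; rs-refl = λ φ → rs-refl (T φ)
    ; rs-weak = λ Γ Δ Γ' Δ' f g → rs-weak _ _ _ _ (map⁺ T f) (map⁺ T g)
    ; rs-cut = λ Γ Δ φ → rs-cut _ _ (T φ) }
  isMsi .IsMsiRS.msi (thm d) = theorem (T-sound (MsiCl-mono (λ ()) d))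
  isMsi .IsMsiRS.msi (mpR φ ψ) = replace (modal (mpR (T φ) (T ψ)))
    (λ { (here refl) → rs-weak _ _ _ _ (λ { (here e) → here e }) id (rs-refl (T φ))
       ; (there (here refl)) → rs-weak _ _ _ _ (λ { (here e) → there (here e) }) id
           (→-rule □⁺-elim) })
    λ { (here refl) → rs-refl _ }
  isMsi .IsMsiRS.msi (necR φ) = modal (necR (T φ))

-- The rules all of whose clausal readings lie in L form a modal rule system
-- containing σR L; reading pₘ n as pᵢ n then recovers L.
Readings : Pred (Rule IFm) 0ℓ → Pred (Rule MFm) 0ℓ
Readings L ru = ∀ c → L (mapR (int ∘ cnf c) ru)

Readings-isModRS : ∀ {L} → NExtKMR L → IsModRS (Readings L)
Readings-isModRS {L} NL = record
  { is-rs = record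
    { rs-subst = λ s ru d c → subst L
        (sym (trans (cong (mapR (int ∘ cnf c)) (substR-mapR substM s ru))
             (trans (mapR-∘ (int ∘ cnf c) (substM s) ru)
                    (mapR-cong (cong int ∘ cnf-subst c s) ru))))
        (d (cnf c ∘ s))
    ; rs-refl = λ φ c → rs-refl _
    ; rs-weak = λ Γ Δ Γ' Δ' f g d c → rs-weak _ _ _ _ (map⁺ _ f) (map⁺ _ g) (d c)
    ; rs-cut = λ Γ Δ φ d e c → rs-cut _ _ _ (d c) (e c) }
  ; modal = λ
    { (thm d) c → theorem (cnf-sound (ModCl-mono (λ ()) d) c)
    ; (mpR φ ψ) c → replace (msi (mpR (int (cnf c φ)) (int (cnf c ψ))))
        (λ { (here refl) → rs-weak _ _ _ _ (λ { (here e) → here e }) id (rs-refl _)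
           ; (there (here refl)) → rs-weak _ _ _ _ (λ { (here e) → there (here e) }) id
               (≤-rule (curry (int-mp (cnf c φ) (cnf c ψ) ∧≤ʳ ∧≤ˡ))) })
        λ { (here refl) → rs-refl _ }
    ; (necR φ) c → trans-rule (msi (necR (int (cnf c φ)))) (≤-rule (int-lit ≤-refl)) } }
  where open KMRules NL

Rep-variable : ∀ n → Rep (cnf (lit ∘ pᵢ) (□⁺ (pₘ n))) (pᵢ n)
Rep-variable n = Rep-resp (Rep-int≤ (Rep-lit _)) (Rep-≤int (Rep-lit _)) (Rep-int (lit (pᵢ n)))

substI-id : ∀ φ → substI pᵢ φ ≡ φ
substI-id (pᵢ n) = refl
substI-id ⊥ᵢ = refl
substI-id ⊤ᵢ = refl
substI-id (φ ∧ᵢ ψ) = cong₂ _∧ᵢ_ (substI-id φ) (substI-id ψ)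
substI-id (φ ∨ᵢ ψ) = cong₂ _∨ᵢ_ (substI-id φ) (substI-id ψ)
substI-id (φ →ᵢ ψ) = cong₂ _→ᵢ_ (substI-id φ) (substI-id ψ)
substI-id (⊠ φ) = cong ⊠ (substI-id φ)

Rep-T-variables : ∀ φ → Rep (cnf (lit ∘ pᵢ) (T φ)) φ
Rep-T-variables φ =
  subst (Rep _) (substI-id φ) (Rep-T (lit ∘ pᵢ) pᵢ Rep-variable φ)

Rep-T-int : ∀ c φ → Rep (cnf c (T φ)) (substI (int ∘ c) φ)
Rep-T-int c = Rep-T c (int ∘ c) (Rep-int ∘ c)

ρσR : ∀ L → NExtKMR L → ρR (σR L) ≐ L
ρσR L NL = (λ {ru} d → back ru (ModRS-least (Readings-isModRS NL)
    [ ModRS-least (Readings-isModRS NL) (λ { (φ , d , refl) c → theorem (cnf-sound d c) })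
    , (λ { (ru , d , refl) c → readings c ru d }) ] d)) ,
  λ d → base (inj₂ (inj₂ (_ , d , refl)))
  where
  open KMRules NL

  readings : ∀ c ru → L ru → L (mapR (int ∘ cnf c) (TR ru))
  readings c ru d = subst L
    (sym (trans (cong (mapR (int ∘ cnf c)) (TR-mapR ru)) (mapR-∘ (int ∘ cnf c) T ru)))
    (replaceR (substI (int ∘ c)) (int ∘ cnf c ∘ T)
      (≤-rule ∘ Rep-int≤ ∘ Rep-T-int c) (≤-rule ∘ Rep-≤int ∘ Rep-T-int c) ru
      (subst L (substR-mapR substI (int ∘ c) ru) (rs-subst (int ∘ c) ru d)))

  back : ∀ ru → Readings L (TR ru) → L ru
  back ru d = subst L (mapR-id (λ _ → refl) ru)
    (replaceR (int ∘ cnf (lit ∘ pᵢ) ∘ T) id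
      (≤-rule ∘ Rep-≤int ∘ Rep-T-variables) (≤-rule ∘ Rep-int≤ ∘ Rep-T-variables) ru
      (subst L (trans (cong (mapR _) (TR-mapR ru)) (mapR-∘ _ T ru)) (d (lit ∘ pᵢ))))

unbox : ∀ ψ → GL (□⁺ (T (int (cnf (lit ∘ pᵢ) ψ))) →ₘ substM (□⁺ ∘ pₘ) ψ)
unbox ψ = □⁺-elim ⨾ ↔-to (T-int-cnf ψ) ⨾ □⁺-elim

box : ∀ ψ → GL (□⁺ (substM (□⁺ ∘ pₘ) ψ) →ₘ T (int (cnf (lit ∘ pᵢ) ψ)))
box ψ = ↔-from (T-int-cnf ψ)

substM-opens : ∀ o s ψ →
  substM o (substM (□⁺ ∘ pₘ) (substM s ψ)) ≡ substM (substM (□⁺ ∘ o) ∘ s) ψ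
substM-opens o s ψ =
  trans (substM-∘ o (□⁺ ∘ pₘ) (substM s ψ)) (substM-∘ (□⁺ ∘ o) s ψ)

σρR : ∀ M → NExtGLR M → σR (ρR M) ≐ M
σρR M NM = ModRS-least (proj₁ NM) [ proj₂ NM , (λ { (_ , d , refl) → d }) ] ,
           λ { {Γ / Δ} d → expand Γ Δ d }
  where
  module M = GLRules NM
  module N = GLRules (σR-NExt (ρR M) (ρR-NExt M NM))

  -- In `M`, substituting `code` and then open variables gives a rule interderivable with a
  -- translation. Inside `σR (ρR M)`, substituting `o` leads from it to the instance from which
  -- `Γ / Δ` is recovered.
  expand : ∀ Γ Δ → M (Γ / Δ) → σR (ρR M) (Γ / Δ)
  -- One substitution must serve the whole rule, so premises and conclusions are treated together.
  expand Γ Δ d with interderivable-instance (Γ ++ Δ)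
  ... | code , o , h = subst (σR (ρR M)) (mapR-id (λ _ → refl) (Γ / Δ))
    (N.replace-map (substM (substM (□⁺ ∘ o) ∘ code)) id Γ Δ
      (λ m → N.□⁺-rule (proj₁ (h (∈-++⁺ˡ m))))
      (λ m → N.□⁺-rule (proj₂ (h (∈-++⁺ʳ Γ m))))
      instance-in-σρ)
    where
    translated : MFm → IFm
    translated = int ∘ cnf (lit ∘ pᵢ) ∘ substM code

    translated-in-M : M (mapR (T ∘ translated) (Γ / Δ))
    translated-in-M = M.replaceR (substM (□⁺ ∘ pₘ) ∘ substM code) (T ∘ translated)
      (M.□⁺-rule ∘ unbox ∘ substM code) (M.□⁺-rule ∘ box ∘ substM code) (Γ / Δ)
      (M.subst-mapR (□⁺ ∘ pₘ) (substM code) (Γ / Δ) (M.rs-subst code (Γ / Δ) d))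

    translated-in-σρ : σR (ρR M) (mapR (T ∘ translated) (Γ / Δ))
    translated-in-σρ = subst (σR (ρR M)) (mapR-∘ T translated (Γ / Δ))
      (base (inj₂ (inj₂ (mapR translated (Γ / Δ) ,
        subst M (sym (mapR-∘ T translated (Γ / Δ))) translated-in-M , refl))))

    instance-in-σρ : σR (ρR M) (mapR (substM (substM (□⁺ ∘ o) ∘ code)) (Γ / Δ))
    instance-in-σρ = subst (σR (ρR M)) (mapR-cong (substM-opens o code) (Γ / Δ))
      (N.subst-mapR o (substM (□⁺ ∘ pₘ) ∘ substM code) (Γ / Δ)
        (N.replaceR (T ∘ translated) (substM (□⁺ ∘ pₘ) ∘ substM code)
          (N.□⁺-rule ∘ box ∘ substM code) (N.□⁺-rule ∘ unbox ∘ substM code) (Γ / Δ)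
          translated-in-σρ))

-- Logics

σL-NExt : ∀ L → NExtKM L → NExtGL (σL L)
σL-NExt L _ = ModCl-isNormal , (λ d → base (inj₁ d))

ρL-NExt : ∀ M → NExtGL M → NExtKM (ρL M)
ρL-NExt M NM = record
  { ml-IPCK = λ d → proj₂ NM (T-sound (MsiCl-mono (λ ()) d))
  ; ml-subst = λ s φ d →
      nl-mp _ _ (nl-subst (T ∘ s) (T φ) d) (proj₂ NM (↔-from (T-subst s φ)))
  ; ml-mp = λ φ ψ d e → nl-mp _ _ d (nl-mp _ _ e (proj₂ NM □⁺-elim))
  ; ml-nec = λ φ → nl-nec (T φ) } , λ d → proj₂ NM (T-sound d)
  where open IsNormalModalLogic (proj₁ NM)

ReadingsL : Pred IFm 0ℓ → Pred MFm 0ℓ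
ReadingsL L φ = ∀ c → L (int (cnf c φ))

ReadingsL-isNormal : ∀ {L} → NExtKM L → IsNormalModalLogic (ReadingsL L)
ReadingsL-isNormal {L} NL = record
  { nl-K = λ d c → proj₂ NL (cnf-sound (ModCl-mono (λ ()) d) c)
  ; nl-subst = λ s φ d c → subst (L ∘ int) (sym (cnf-subst c s φ)) (d (cnf c ∘ s))
  ; nl-mp = λ φ ψ d e c → ml-mp _ _ (d c) (ml-mp _ _ (e c)
      (proj₂ NL (curry (int-mp (cnf c φ) (cnf c ψ) ∧≤ʳ ∧≤ˡ))))
  ; nl-nec = λ φ d c → ml-mp _ _ (ml-nec _ (d c)) (proj₂ NL (int-lit ≤-refl)) }
  where open IsMsiLogic (proj₁ NL)

ρσL : ∀ L → NExtKM L → ρL (σL L) ≐ L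
ρσL L NL =
  (λ {φ} d → ml-mp _ _
    (ModCl-least (ReadingsL-isNormal NL)
      [ (λ d c → proj₂ NL (cnf-sound d c)) , (λ { (φ , d , refl) c → readings φ d c }) ]
      d (lit ∘ pᵢ))
    (proj₂ NL (Rep-int≤ (Rep-T-variables φ)))) ,
  λ d → base (inj₂ (_ , d , refl))
  where
  open IsMsiLogic (proj₁ NL)

  readings : ∀ φ → L φ → ReadingsL L (T φ)
  readings φ d c =
    ml-mp _ _ (ml-subst (int ∘ c) φ d) (proj₂ NL (Rep-≤int (Rep-T-int c φ)))

□⁺-mp : ∀ {M φ ψ} → NExtGL M → M φ → GL (□⁺ φ →ₘ ψ) → M ψ
□⁺-mp {φ = φ} NM d e = nl-mp _ _ d (nl-mp _ _ (nl-nec φ d)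
  (proj₂ NM (taut₃ (λ a b c → (a ⩓ b ⇒ c) ⇒ a ⇒ b ⇒ c) · e)))
  where open IsNormalModalLogic (proj₁ NM)

σρL : ∀ M → NExtGL M → σL (ρL M) ≐ M
σρL M NM = ModCl-least (proj₁ NM) [ proj₂ NM , (λ { (_ , d , refl) → d }) ] ,
           λ {φ} → expand φ
  where
  Nσρ : NExtGL (σL (ρL M))
  Nσρ = σL-NExt (ρL M) (ρL-NExt M NM)

  expand : ∀ φ → M φ → σL (ρL M) φ
  expand φ d with interderivable-instance (φ ∷ [])
  ... | code , o , h = □⁺-mp Nσρ
    (subst (σL (ρL M)) (substM-opens o code φ)
      (sub o (□⁺-mp Nσρ (base (inj₂ (_ , translated-in-M , refl))) (unbox (substM code φ)))))
    (proj₂ (h (here refl)))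
    where
    open IsNormalModalLogic (proj₁ NM)

    translated-in-M : M (T (int (cnf (lit ∘ pᵢ) (substM code φ))))
    translated-in-M = □⁺-mp NM (nl-subst (□⁺ ∘ pₘ) _ (nl-subst code φ d))
      (box (substM code φ))

-- Complete lattices

record ClosureLattice {A : Set} (N : Pred A 0ℓ → Set)
    (⋁' : {I : Set} → (I → Pred A 0ℓ) → Pred A 0ℓ) : Set₁ where
  field
    ⋀-closed : ∀ {I : Set} (Ls : I → Pred A 0ℓ) → (∀ i → N (Ls i)) → N (⋀ Ls)
    ⋁-closed : ∀ {I : Set} (Ls : I → Pred A 0ℓ) → N (⋁' Ls)
    ⋁-upper  : ∀ {I : Set} (Ls : I → Pred A 0ℓ) i → Ls i ⊆ᵖ ⋁' Ls
    ⋁-least  : ∀ {I : Set} (Ls : I → Pred A 0ℓ) {L} → N L → (∀ i → Ls i ⊆ᵖ L) → ⋁' Ls ⊆ᵖ L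

open ClosureLattice

-- Meets and joins are determined by the order, which mutually inverse monotone maps preserve. The
-- hypotheses are symmetric, so `meets` and `joins` serve for both maps.
inverse-monotone⇒iso : {A B : Set} {NA : Pred A 0ℓ → Set} {NB : Pred B 0ℓ → Set}
  {⋁A : {I : Set} → (I → Pred A 0ℓ) → Pred A 0ℓ}
  {⋁B : {I : Set} → (I → Pred B 0ℓ) → Pred B 0ℓ} →
  ClosureLattice NA ⋁A → ClosureLattice NB ⋁B →
  (f : Pred A 0ℓ → Pred B 0ℓ) (g : Pred B 0ℓ → Pred A 0ℓ) →
  (∀ {L L'} → L ⊆ᵖ L' → f L ⊆ᵖ f L') → (∀ {M M'} → M ⊆ᵖ M' → g M ⊆ᵖ g M') →
  (∀ L → NA L → NB (f L)) → (∀ M → NB M → NA (g M)) →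
  (∀ L → NA L → g (f L) ≐ L) → (∀ M → NB M → f (g M) ≐ M) →
  CompleteLatticeIso NA NB ⋁A ⋁B f g
inverse-monotone⇒iso {NA = NA} {NB} {⋁A} {⋁B} CA CB f g f↑ g↑ f∈ g∈ gf fg = record
  { f-into = f∈
  ; g-into = g∈
  ; g∘f = gf
  ; f∘g = fg
  ; f-⋀ = meets CA CB f g f↑ g↑ f∈ g∈ gf fg
  ; f-⋁ = joins CA CB f g f↑ g↑ f∈ g∈ gf fg
  ; g-⋀ = meets CB CA g f g↑ f↑ g∈ f∈ fg gf
  ; g-⋁ = joins CB CA g f g↑ f↑ g∈ f∈ fg gf }
  where
  module _ {A B : Set} {NA : Pred A 0ℓ → Set} {NB : Pred B 0ℓ → Set}
    {⋁A : {I : Set} → (I → Pred A 0ℓ) → Pred A 0ℓ}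
    {⋁B : {I : Set} → (I → Pred B 0ℓ) → Pred B 0ℓ}
    (CA : ClosureLattice NA ⋁A) (CB : ClosureLattice NB ⋁B)
    (f : Pred A 0ℓ → Pred B 0ℓ) (g : Pred B 0ℓ → Pred A 0ℓ)
    (f↑ : ∀ {L L'} → L ⊆ᵖ L' → f L ⊆ᵖ f L') (g↑ : ∀ {M M'} → M ⊆ᵖ M' → g M ⊆ᵖ g M')
    (f∈ : ∀ L → NA L → NB (f L)) (g∈ : ∀ M → NB M → NA (g M))
    (gf : ∀ L → NA L → g (f L) ≐ L) (fg : ∀ M → NB M → f (g M) ≐ M) where

    meets : ∀ {I : Set} (Ls : I → Pred A 0ℓ) → (∀ i → NA (Ls i)) → f (⋀ Ls) ≐ ⋀ (f ∘ Ls)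
    meets Ls N =
      (λ d i → f↑ (λ x → x i) d) ,
      -- The meet of the images is `f` of its `g`-image, and monotonicity of `g` puts that image
      -- below every `Ls i`.
      λ d → f↑ (λ x i → proj₁ (gf (Ls i) (N i)) (g↑ (λ y → y i) x))
               (proj₂ (fg _ (⋀-closed CB (f ∘ Ls) (λ i → f∈ _ (N i)))) d)

    joins : ∀ {I : Set} (Ls : I → Pred A 0ℓ) → (∀ i → NA (Ls i)) → f (⋁A Ls) ≐ ⋁B (f ∘ Ls)
    joins Ls N =
      -- The `g`-image of the join on the right bounds every `Ls i`, since `Ls i` is `g (f (Ls i))`.
      (λ d → proj₁ (fg _ (⋁-closed CB (f ∘ Ls)))
        (f↑ (⋁-least CA Ls (g∈ _ (⋁-closed CB (f ∘ Ls))) λ i x →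
              g↑ (⋁-upper CB (f ∘ Ls) i) (proj₂ (gf (Ls i) (N i)) x)) d)) ,
      ⋁-least CB (f ∘ Ls) (f∈ _ (⋁-closed CA Ls)) λ i → f↑ (⋁-upper CA Ls i)

KMR-lattice : ClosureLattice NExtKMR ⋁KMR
KMR-lattice .⋀-closed Ls N = record
  { is-rs = record
    { rs-subst = λ s ru d i → rs-subst (rs i) s ru (d i)
    ; rs-refl = λ φ i → rs-refl (rs i) φ
    ; rs-weak = λ Γ Δ Γ' Δ' g h d i → rs-weak (rs i) Γ Δ Γ' Δ' g h (d i)
    ; rs-cut = λ Γ Δ φ d e i → rs-cut (rs i) Γ Δ φ (d i) (e i) }
  ; msi = λ d i → IsMsiRS.msi (proj₁ (N i)) d } , λ d i → proj₂ (N i) d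
  where
  open IsRuleSystem
  rs : ∀ i → IsRuleSystem substI (Ls i)
  rs i = IsMsiRS.is-rs (proj₁ (N i))
KMR-lattice .⋁-closed Ls = MsiRS-isMsiRS , (λ d → base (inj₂ (inj₁ d)))
KMR-lattice .⋁-upper Ls i d = base (inj₂ (inj₂ (i , d)))
KMR-lattice .⋁-least Ls NL h =
  MsiRS-least (proj₁ NL) [ proj₂ NL , (λ (i , d) → h i d) ]

GLR-lattice : ClosureLattice NExtGLR ⋁GLR
GLR-lattice .⋀-closed Ms N = record
  { is-rs = record
    { rs-subst = λ s ru d i → rs-subst (rs i) s ru (d i)
    ; rs-refl = λ φ i → rs-refl (rs i) φ
    ; rs-weak = λ Γ Δ Γ' Δ' g h d i → rs-weak (rs i) Γ Δ Γ' Δ' g h (d i)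
    ; rs-cut = λ Γ Δ φ d e i → rs-cut (rs i) Γ Δ φ (d i) (e i) }
  ; modal = λ d i → IsModRS.modal (proj₁ (N i)) d } , λ d i → proj₂ (N i) d
  where
  open IsRuleSystem
  rs : ∀ i → IsRuleSystem substM (Ms i)
  rs i = IsModRS.is-rs (proj₁ (N i))
GLR-lattice .⋁-closed Ms = ModRS-isModRS , (λ d → base (inj₂ (inj₁ d)))
GLR-lattice .⋁-upper Ms i d = base (inj₂ (inj₂ (i , d)))
GLR-lattice .⋁-least Ms NM h =
  ModRS-least (proj₁ NM) [ proj₂ NM , (λ (i , d) → h i d) ]

KM-lattice : ClosureLattice NExtKM ⋁KM
KM-lattice .⋀-closed Ls N = record
  { ml-IPCK = λ d i → ml-IPCK (proj₁ (N i)) d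
  ; ml-subst = λ s φ d i → ml-subst (proj₁ (N i)) s φ (d i)
  ; ml-mp = λ φ ψ d e i → ml-mp (proj₁ (N i)) φ ψ (d i) (e i)
  ; ml-nec = λ φ d i → ml-nec (proj₁ (N i)) φ (d i) } , λ d i → proj₂ (N i) d
  where open IsMsiLogic
KM-lattice .⋁-closed Ls = MsiCl-isMsiLogic , (λ d → base (inj₁ d))
KM-lattice .⋁-upper Ls i d = base (inj₂ (i , d))
KM-lattice .⋁-least Ls NL h =
  MsiCl-least (proj₁ NL) [ proj₂ NL , (λ (i , d) → h i d) ]

GL-lattice : ClosureLattice NExtGL ⋁GL
GL-lattice .⋀-closed Ms N = record
  { nl-K = λ d i → nl-K (proj₁ (N i)) d
  ; nl-subst = λ s φ d i → nl-subst (proj₁ (N i)) s φ (d i)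
  ; nl-mp = λ φ ψ d e i → nl-mp (proj₁ (N i)) φ ψ (d i) (e i)
  ; nl-nec = λ φ d i → nl-nec (proj₁ (N i)) φ (d i) } , λ d i → proj₂ (N i) d
  where open IsNormalModalLogic
GL-lattice .⋁-closed Ms = ModCl-isNormal , (λ d → base (inj₁ d))
GL-lattice .⋁-upper Ms i d = base (inj₂ (i , d))
GL-lattice .⋁-least Ms NM h =
  ModCl-least (proj₁ NM) [ proj₂ NM , (λ (i , d) → h i d) ]

σR-mono : ∀ {L L'} → L ⊆ᵖ L' → σR L ⊆ᵖ σR L'
σR-mono h = ModRS-least ModRS-isModRS
  [ (λ d → base (inj₂ (inj₁ d))) , (λ (ru , d , e) → base (inj₂ (inj₂ (ru , h d , e)))) ]

σL-mono : ∀ {L L'} → L ⊆ᵖ L' → σL L ⊆ᵖ σL L'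
σL-mono h = ModCl-mono [ inj₁ , (λ (φ , d , e) → inj₂ (φ , h d , e)) ]

theorem5p35 : CompleteLatticeIso NExtKMR NExtGLR ⋁KMR ⋁GLR σR ρR
    × CompleteLatticeIso NExtKM NExtGL ⋁KM ⋁GL σL ρL
theorem5p35 =
  inverse-monotone⇒iso KMR-lattice GLR-lattice σR ρR σR-mono (λ h → h)
    σR-NExt ρR-NExt ρσR σρR ,
  inverse-monotone⇒iso KM-lattice GL-lattice σL ρL σL-mono (λ h → h)
    σL-NExt ρL-NExt ρσL σρL
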